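{- Let $l\ge 0$ be an integer. Let $A\in \mathrm{GL}_n(k((z)))$ have dominant coweight $\rho(A)=(l)=(l,0^{n-1})$ and let $B\in\mathrm{GL}_n(k((z)))$. Write the symmetric coweights as $\sigma(B)=(a_1,\dots,a_n)$ and $\sigma(AB)=(b_1,\dots,b_n)$, in decreasing order. Then $a_{i+1}\le b_i\le a_{i-1}$ for all $i$ (where the inequality $a_{i+1}\le b_i$ is asserted for $1\le i\le n-1$ and $b_i\le a_{i-1}$ for $2\le i\le n$).
   Context: $k$ is a finite field with $\mathrm{char}(k)\ne 2$. Let $G=\mathrm{GL}_n(k((z)))$, $K=\mathrm{GL}_n(k[[z]])$, $H=\mathrm{GL}_n(k((z^2)))$. Dominant coweight: every $g\in G$ lies in $K\,\mathrm{diag}(z^{\lambda_1},\dots,z^{\lambda_n})\,K$ for a unique sequence of integers $\lambda_1\ge\dots\ge\lambda_n$; put $\rho(g)=(\lambda_1,\dots,\lambda_n)$. Strings of zeros in such sequences may be omitted when writing them. Symmetric coweight: every $g\in G$ lies in $K\Lambda H$ for a block diagonal matrix $\Lambda$ with diagonal blocks among $(1)$, $(z)$, $\begin{pmatrix}1&z\\0&z^i\end{pmatrix}$ ($i>1$), and $\Lambda$ is unique up to the order of the blocks. The symmetric coweight $\sigma(g)$ is the decreasing sequence of length $n$ obtained by letting each block $(1)$ contribute $0$, each block $(z)$ contribute $1$, and each block $\begin{pmatrix}1&z\\0&z^i\end{pmatrix}$ contribute $i$ and $0$. -}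

module Defs where

open import Algebra.Apartness.Bundles using (HeytingCommutativeRing; HeytingField)
open import Algebra.Bundles using (CommutativeRing)
open import Algebra.Bundles.Raw using (RawRing)
import Algebra.Definitions.RawMonoid as RawMonoidDefinitions
open import Data.Fin.Base as Fin using (Fin; toℕ; splitAt)
open import Data.Integer.Base as ℤ using (ℤ; +_; -[1+_]; 0ℤ; 1ℤ)
open import Data.Nat.Base as ℕ using (ℕ; zero; suc; _∸_)
open import Data.Product.Base using (Σ-syntax; ∃-syntax; _×_)
open import Data.Sum.Base using (inj₁; inj₂)
open import Data.Vec.Functional using (Vector; []; _∷_; _++_)
open import Data.Vec.Functional.Relation.Binary.Permutation using (_↭_)
open import Function.Bundles using (Inverse; _⇔_)
open import Level using (_⊔_)
import Relation.Binary.PropositionalEquality.Properties as ≡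
open import Relation.Unary using (Pred; _∈_; U)

record FiniteField c ℓ₁ ℓ₂ : Set (Level.suc (c ⊔ ℓ₁ ⊔ ℓ₂)) where
  field
    heytingField : HeytingField c ℓ₁ ℓ₂

  open HeytingField heytingField public
  open HeytingCommutativeRing heytingCommutativeRing public
    using (commutativeRing)

  field
    finite : ∃[ q ] Inverse setoid (≡.setoid (Fin q))

-- `HasCharacteristic R p`: p generates the kernel of ℤ → R, so p = 0 is
-- allowed.
HasCharacteristic : ∀ {c ℓ} → CommutativeRing c ℓ → ℕ → Set ℓ
HasCharacteristic R p = ∀ m → (m · 1# ≈ 0#) ⇔ (p ∣ m)
  where
  open CommutativeRing R
  open RawMonoidDefinitions +-rawMonoid using () renaming (_×_ to _·_)
  open import Data.Nat.Divisibility using (_∣_)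

module Laurent {c ℓ} (R : CommutativeRing c ℓ) where
  private module R = CommutativeRing R
  open RawMonoidDefinitions R.+-rawMonoid using (sum)

  PowerSeries : Set c
  PowerSeries = ℕ → R.Carrier

  infix  4 _≈_
  infixl 6 _+_
  infixl 7 _*_
  infix  8 -_
  infix  9 z^_

  -- `shift d s` is z^d · s.  Neither d nor s is determined by the series:
  -- the leading coefficients of s may vanish, and series are compared
  -- through their coefficients.
  record LaurentSeries : Set c where
    constructor shift
    field
      start  : ℤ
      series : PowerSeries

  open LaurentSeries

  coeffℤ : PowerSeries → ℤ → R.Carrier
  coeffℤ s (+ j)    = s j
  coeffℤ s -[1+ _ ] = R.0#

  coeff : LaurentSeries → ℤ → R.Carrier
  coeff f m = coeffℤ (series f) (m ℤ.- start f)

  _≈_ : LaurentSeries → LaurentSeries → Set ℓ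
  f ≈ g = ∀ m → coeff f m R.≈ coeff g m

  _+_ : LaurentSeries → LaurentSeries → LaurentSeries
  f + g = shift d (λ j → coeff f (d ℤ.+ + j) R.+ coeff g (d ℤ.+ + j))
    where d = start f ℤ.⊓ start g

  _*_ : LaurentSeries → LaurentSeries → LaurentSeries
  f * g = shift (start f ℤ.+ start g)
    (λ m → sum {suc m} (λ i → series f (toℕ i) R.* series g (m ∸ toℕ i)))

  -_ : LaurentSeries → LaurentSeries
  - f = shift (start f) (λ j → R.- series f j)

  0# : LaurentSeries
  0# = shift 0ℤ (λ _ → R.0#)

  z^_ : ℤ → LaurentSeries
  z^ d = shift d λ where
    zero    → R.1#
    (suc _) → R.0#

  1# : LaurentSeries
  1# = z^ 0ℤ

  rawRing : RawRing c ℓ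
  rawRing = record
    { Carrier = LaurentSeries
    ; _≈_     = _≈_
    ; _+_     = _+_
    ; _*_     = _*_
    ; -_      = -_
    ; 0#      = 0#
    ; 1#      = 1#
    }

  -- R[[z]] as a subset of R((z)).
  Integral : Pred LaurentSeries ℓ
  Integral f = ∀ m → m ℤ.< 0ℤ → coeff f m R.≈ R.0#

  -- R((z²)) as a subset of R((z)).
  Even : Pred LaurentSeries ℓ
  Even f = ∀ m → coeff f (+ 2 ℤ.* m ℤ.+ 1ℤ) R.≈ R.0#

module Matrices {c ℓ} (R : RawRing c ℓ) where
  open RawRing R
  open RawMonoidDefinitions +-rawMonoid using (sum)

  Matrix : ℕ → Set c
  Matrix n = Fin n → Fin n → Carrier

  infix  4 _≈ᴹ_
  infixl 7 _*ᴹ_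
  infixr 5 _⊕_

  _≈ᴹ_ : ∀ {n} → Matrix n → Matrix n → Set ℓ
  M ≈ᴹ N = ∀ i j → M i j ≈ N i j

  _*ᴹ_ : ∀ {n} → Matrix n → Matrix n → Matrix n
  (M *ᴹ N) i j = sum (λ k → M i k * N k j)

  diag : ∀ {n} → Vector Carrier n → Matrix n
  diag {suc n} d Fin.zero    Fin.zero    = d Fin.zero
  diag {suc n} d Fin.zero    (Fin.suc j) = 0#
  diag {suc n} d (Fin.suc i) Fin.zero    = 0#
  diag {suc n} d (Fin.suc i) (Fin.suc j) = diag (λ k → d (Fin.suc k)) i j

  1ᴹ : ∀ {n} → Matrix n
  1ᴹ = diag (λ _ → 1#)

  _⊕_ : ∀ {m n} → Matrix m → Matrix n → Matrix (m ℕ.+ n)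
  _⊕_ {m} M N i j with splitAt m i | splitAt m j
  ... | inj₁ i′ | inj₁ j′ = M i′ j′
  ... | inj₁ _  | inj₂ _  = 0#
  ... | inj₂ _  | inj₁ _  = 0#
  ... | inj₂ i′ | inj₂ j′ = N i′ j′

  -- GL_n of the subring P of R, as a subset of the n × n matrices over R:
  -- both the matrix and its inverse have entries in P.
  GL : ∀ {p} → Pred Carrier p → ∀ {n} → Pred (Matrix n) (c ⊔ ℓ ⊔ p)
  GL P {n} M = (∀ i j → M i j ∈ P) ×
    Σ[ M⁻¹ ∈ Matrix n ] (∀ i j → M⁻¹ i j ∈ P) ×
                        (M *ᴹ M⁻¹ ≈ᴹ 1ᴹ) × (M⁻¹ *ᴹ M ≈ᴹ 1ᴹ)

Decreasing : ∀ {n} → Vector ℤ n → Set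
Decreasing a = ∀ {i j} → i Fin.≤ j → a j ℤ.≤ a i

module Coweights {c ℓ₁ ℓ₂} (k : FiniteField c ℓ₁ ℓ₂) where
  open Laurent (FiniteField.commutativeRing k) public
    using (LaurentSeries; z^_; 0#; 1#; Integral; Even; rawRing)
  open Matrices rawRing public

  G K H : ∀ {n} → Pred (Matrix n) (c ⊔ ℓ₁)
  G = GL U
  K = GL Integral
  H = GL Even

  data Block : ℕ → Set where
    one  : Block 1
    z    : Block 1
    unip : (i : ℕ) → 1 ℕ.< i → Block 2

  blockMatrix : ∀ {m} → Block m → Matrix m
  blockMatrix one        = λ _ _ → 1#
  blockMatrix z          = λ _ _ → z^ 1ℤ
  blockMatrix (unip i _) = (1# ∷ z^ 1ℤ   ∷ [])
                         ∷ (0# ∷ z^ (+ i) ∷ [])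
                         ∷ []

  blockCoweight : ∀ {m} → Block m → Vector ℤ m
  blockCoweight one        = 0ℤ ∷ []
  blockCoweight z          = 1ℤ ∷ []
  blockCoweight (unip i _) = + i ∷ 0ℤ ∷ []

  infixr 5 _◂_

  data Blocks : ℕ → Set where
    ∅   : Blocks 0
    _◂_ : ∀ {m n} → Block m → Blocks n → Blocks (m ℕ.+ n)

  blocksMatrix : ∀ {n} → Blocks n → Matrix n
  blocksMatrix ∅        = λ ()
  blocksMatrix (b ◂ bs) = blockMatrix b ⊕ blocksMatrix bs

  blocksCoweight : ∀ {n} → Blocks n → Vector ℤ n
  blocksCoweight ∅        = []
  blocksCoweight (b ◂ bs) = blockCoweight b ++ blocksCoweight bs

  -- ρ(g) = a and σ(g) = a, as relations: computing the coweight as a function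
  -- of g would need the existence and uniqueness of the decompositions.
  HasDominantCoweight : ∀ {n} → Matrix n → Vector ℤ n → Set (c ⊔ ℓ₁)
  HasDominantCoweight {n} g a = Decreasing a ×
    Σ[ p ∈ Matrix n ] Σ[ q ∈ Matrix n ] p ∈ K × q ∈ K ×
      (g ≈ᴹ p *ᴹ diag (λ i → z^ (a i)) *ᴹ q)

  HasSymmetricCoweight : ∀ {n} → Matrix n → Vector ℤ n → Set (c ⊔ ℓ₁)
  HasSymmetricCoweight {n} g a = Decreasing a ×
    Σ[ Λ ∈ Blocks n ] a ↭ blocksCoweight Λ ×
    Σ[ p ∈ Matrix n ] Σ[ h ∈ Matrix n ] p ∈ K × h ∈ H ×
      (g ≈ᴹ p *ᴹ blocksMatrix Λ *ᴹ h)

{-# OPTIONS --safe #-}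
module Submission where

open import Algebra.Bundles using (CommutativeRing; Monoid)
import Algebra.Consequences.Setoid as Consequences
import Algebra.Properties.CommutativeSemigroup as CommutativeSemigroupProperties
import Algebra.Properties.Ring as RingProperties
import Algebra.Properties.Semiring.Sum as SemiringSum
import Algebra.Solver.Monoid as MonoidSolver
open import Data.Fin.Base as Fin
  using (Fin; zero; suc; toℕ; fromℕ<; inject₁; punchIn; punchOut; splitAt; _↑ˡ_; _↑ʳ_)
open import Data.Fin.Permutation as Permutation
  using (Permutation; Permutation′; _⟨$⟩ʳ_; _⟨$⟩ˡ_; inverseˡ)
import Data.Fin.Properties as Fin
open import Data.Integer.Base as ℤ using (ℤ; +_; -[1+_]; 0ℤ; 1ℤ; -1ℤ; _≤_)
import Data.Integer.DivMod as ℤ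
import Data.Integer.Properties as ℤ
open import Data.Integer.Tactic.RingSolver using (solve-∀)
open import Data.Nat.Base as ℕ using (ℕ; zero; suc; z≤n; s≤s; _∸_)
import Data.Nat.Properties as ℕ
open import Data.Product.Base using (Σ-syntax; ∃-syntax; _×_; _,_; proj₁; proj₂)
open import Data.Sum.Base as Sum using (_⊎_; inj₁; inj₂)
open import Data.Sum.Function.Propositional using (_⊎-↔_)
open import Data.Vec.Functional using (Vector; []; _∷_; _++_; replicate)
open import Data.Vec.Functional.Properties using (lookup-++ˡ; lookup-++ʳ)
open import Data.Vec.Functional.Relation.Binary.Permutation using (_↭_)
open import Data.Vec.Functional.Relation.Binary.Permutation.Properties using (↭-refl; ↭-trans)
open import Function.Base using (_∘_; flip; id)
open import Function.Bundles using (Inverse)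
open import Function.Construct.Composition using (_↔-∘_)
open import Function.Construct.Symmetry using (↔-sym)
open import Level using (Level; _⊔_) renaming (suc to lsuc)
open import Relation.Binary.Bundles using (Setoid)
open import Relation.Binary.Definitions using (tri<; tri≈; tri>)
open import Relation.Binary.PropositionalEquality as ≡ using (_≡_; _≢_)
import Relation.Binary.Reasoning.Setoid as SetoidReasoning
open import Relation.Nullary.Decidable using (Dec; yes; no; map′)
open import Relation.Nullary.Negation using (¬_; contradiction)
open import Relation.Unary using (Pred; _∈_; _⊆_)

open import Defs

-- A matrix g determines two k[[z²]]-lattices: the integral row vectors y with yg
-- even, and the integral column vectors gu with u even.  Both see σ(g): modulo
-- z, the vectors x such that zᵉx lies in the k[[z]]-span of the lattice form a
-- space of dimension #{i : σ(g)ᵢ ≤ e}.  If B = pΛh and AB = p′Λ′h′, then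
-- C = p′⁻¹Ap satisfies CΛ = Λ′(h′h⁻¹), so y ↦ yC maps the row lattice of Λ′ to that
-- of Λ, and x ↦ Cx maps the column lattice of Λ to that of Λ′.  As ρ(A) = (l, 0, …, 0)
-- with l ≥ 0, the matrix C is integral and its residue has corank at most 1.
-- Hence #{i : bᵢ ≤ e} ≤ #{i : aᵢ ≤ e} + 1 and #{i : aᵢ ≤ e} ≤ #{i : bᵢ ≤ e} + 1.

-- Each inequality needs its own lattice. C is integral with residue of corank at most 1, so along
-- the map it induces each residue space loses at most one dimension; for l > 0 the inverse of C is
-- not integral and bounds nothing in return. Rows and columns move in opposite directions under C,
-- and this supplies the second inequality. That the lattices see σ comes from parity: k((z)) is the
-- sum of k((z²)) and z k((z²)), so on each block the conditions "integral" and "even" can be solved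
-- coefficient by coefficient. The numbers σ(g)ᵢ then appear as the exponents of the elementary
-- divisors of the k[[z]]-span in k[[z]]ⁿ. For block diagonal Λ the residue spaces are spanned by
-- unit vectors. Hence no dimension is computed: the inclusion of residue spaces says that certain
-- entries of the residue of C vanish. If interlacing failed at position i, counted from 0, there
-- would be a zero block with m + 1 - i rows and i + 2 columns in a matrix of size m + 1. Its sides
-- add up to m + 3, which forces corank at least 2.

-- Convolution of power series

module PowerSeriesProperties {c ℓ} (R : CommutativeRing c ℓ) where
  open CommutativeRing R
  open SemiringSum semiring
    using (sum; sum-cong-≋; ∑-distrib-+; *-distribˡ-sum; sum-replicate-zero)
  open CommutativeSemigroupProperties +-commutativeSemigroup using (x∙yz≈y∙xz)
  open SetoidReasoning setoid
  open Laurent R using (PowerSeries)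

  infix  4 _≋_
  infixl 7 _⊛_

  _≋_ : PowerSeries → PowerSeries → Set ℓ
  s ≋ t = ∀ m → s m ≈ t m

  _⊛_ : PowerSeries → PowerSeries → PowerSeries
  (s ⊛ t) m = sum {suc m} (λ i → s (toℕ i) * t (m ∸ toℕ i))

  private
    term : PowerSeries → PowerSeries → ∀ m → Fin (suc m) → Carrier
    term s t m i = s (toℕ i) * t (m ∸ toℕ i)

  ⊛-cong : ∀ {s s′ t t′} → s ≋ s′ → t ≋ t′ → s ⊛ t ≋ s′ ⊛ t′
  ⊛-cong {s} {s′} {t} {t′} p q m = sum-cong-≋ {suc m} {term s t m} {term s′ t′ m}
    (λ i → *-cong (p (toℕ i)) (q (m ∸ toℕ i)))

  ⊛-coeff₀ : ∀ s t → (s ⊛ t) 0 ≈ s 0 * t 0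
  ⊛-coeff₀ s t = +-identityʳ _

  ⊛-zeroˡ : ∀ {s} → s ≋ (λ _ → 0#) → ∀ t → s ⊛ t ≋ (λ _ → 0#)
  ⊛-zeroˡ {s} s≋0 t m = begin
    sum (term s t m)
      ≈⟨ sum-cong-≋ {suc m} {term s t m} (λ i → trans (*-congʳ (s≋0 (toℕ i))) (zeroˡ _)) ⟩
    sum {suc m} (λ _ → 0#)
      ≈⟨ sum-replicate-zero (suc m) ⟩
    0#                         ∎

  -- The definition of _⊛_ unfolds along the first factor:
  -- (s ⊛ t) (suc m) is s 0 * t (suc m) + (s ∘ suc ⊛ t) m.
  ⊛-sucʳ : ∀ s t m → (s ⊛ t) (suc m) ≈ s (suc m) * t 0 + (s ⊛ t ∘ suc) m
  ⊛-sucʳ s t zero    = x∙yz≈y∙xz _ _ _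
  ⊛-sucʳ s t (suc m) = begin
    s 0 * t (suc (suc m)) + (s ∘ suc ⊛ t) (suc m)
      ≈⟨ +-congˡ (⊛-sucʳ (s ∘ suc) t m) ⟩
    s 0 * t (suc (suc m)) + (s (suc (suc m)) * t 0 + (s ∘ suc ⊛ t ∘ suc) m)
      ≈⟨ x∙yz≈y∙xz _ _ _ ⟩
    s (suc (suc m)) * t 0 + (s ⊛ t ∘ suc) (suc m) ∎

  ⊛-comm : ∀ s t → s ⊛ t ≋ t ⊛ s
  ⊛-comm s t zero    = +-congʳ (*-comm _ _)
  ⊛-comm s t (suc m) = begin
    s 0 * t (suc m) + (s ∘ suc ⊛ t) m  ≈⟨ +-cong (*-comm _ _) (⊛-comm (s ∘ suc) t m) ⟩
    t (suc m) * s 0 + (t ⊛ s ∘ suc) m  ≈⟨ ⊛-sucʳ t s m ⟨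
    (t ⊛ s) (suc m)                    ∎

  ⊛-distribʳ : ∀ u s t → (λ i → s i + t i) ⊛ u ≋ (λ m → (s ⊛ u) m + (t ⊛ u) m)
  ⊛-distribʳ u s t m = begin
    sum {suc m} (λ i → (s (toℕ i) + t (toℕ i)) * u (m ∸ toℕ i))
      ≈⟨ sum-cong-≋ {suc m} (λ i → distribʳ (u (m ∸ toℕ i)) (s (toℕ i)) (t (toℕ i))) ⟩
    sum (λ i → term s u m i + term t u m i)
      ≈⟨ ∑-distrib-+ (term s u m) (term t u m) ⟩
    (s ⊛ u) m + (t ⊛ u) m ∎

  ⊛-scaleˡ : ∀ a s t → (λ i → a * s i) ⊛ t ≋ (λ m → a * (s ⊛ t) m)
  ⊛-scaleˡ a s t m = begin
    sum {suc m} (λ i → a * s (toℕ i) * t (m ∸ toℕ i))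
      ≈⟨ sum-cong-≋ {suc m} (λ i → *-assoc a (s (toℕ i)) (t (m ∸ toℕ i))) ⟩
    sum (λ i → a * term s t m i)
      ≈⟨ *-distribˡ-sum a (term s t m) ⟨
    a * (s ⊛ t) m ∎

  -- Induction on the degree. Writing s = s₀ + z s′, the tail of `s ⊛ t` is s₀ t′ + s′ ⊛ t, where t′
  -- is the tail of t; distributivity and scaling then leave associativity for s′ in one degree
  -- less.
  ⊛-assoc : ∀ s t u → s ⊛ t ⊛ u ≋ s ⊛ (t ⊛ u)
  ⊛-assoc s t u zero = begin
    (s ⊛ t) 0 * u 0 + 0#     ≈⟨ +-congʳ (*-congʳ (⊛-coeff₀ s t)) ⟩
    s 0 * t 0 * u 0 + 0#     ≈⟨ +-congʳ (*-assoc _ _ _) ⟩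
    s 0 * (t 0 * u 0) + 0#   ≈⟨ +-congʳ (*-congˡ (⊛-coeff₀ t u)) ⟨
    s 0 * (t ⊛ u) 0 + 0#     ∎
  ⊛-assoc s t u (suc m) = begin
    (s ⊛ t) 0 * u (suc m) + ((s ⊛ t) ∘ suc ⊛ u) m
      ≈⟨ +-cong (*-congʳ (⊛-coeff₀ s t)) (⊛-distribʳ u (λ i → s 0 * t (suc i)) (s ∘ suc ⊛ t) m) ⟩
    s 0 * t 0 * u (suc m) + (((λ i → s 0 * t (suc i)) ⊛ u) m + (s ∘ suc ⊛ t ⊛ u) m)
      ≈⟨ +-cong (*-assoc _ _ _) (+-cong (⊛-scaleˡ (s 0) (t ∘ suc) u m) (⊛-assoc (s ∘ suc) t u m)) ⟩
    s 0 * (t 0 * u (suc m)) + (s 0 * (t ∘ suc ⊛ u) m + (s ∘ suc ⊛ (t ⊛ u)) m)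
      ≈⟨ +-assoc _ _ _ ⟨
    s 0 * (t 0 * u (suc m)) + s 0 * (t ∘ suc ⊛ u) m + (s ∘ suc ⊛ (t ⊛ u)) m
      ≈⟨ +-congʳ (distribˡ _ _ _) ⟨
    s 0 * (t ⊛ u) (suc m) + (s ∘ suc ⊛ (t ⊛ u)) m ∎

  -- Multiplication by z, which compensates for lowering `start` by one.
  delay : PowerSeries → PowerSeries
  delay s zero    = 0#
  delay s (suc m) = s m

  delay-⊛ : ∀ s t → delay s ⊛ t ≋ delay (s ⊛ t)
  delay-⊛ s t zero    = trans (⊛-coeff₀ (delay s) t) (zeroˡ _)
  delay-⊛ s t (suc m) = trans (+-congʳ (zeroˡ _)) (+-identityˡ _)

-- The commutative ring of Laurent series

module LaurentProperties {c ℓ} (R : CommutativeRing c ℓ) where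
  private module R = CommutativeRing R
  open RingProperties R.ring using (-0#≈0#)
  open PowerSeriesProperties R
  open Laurent R
  open LaurentSeries

  private
    m≡d+[m-d] : ∀ m d → m ≡ d ℤ.+ (m ℤ.+ ℤ.- d)
    m≡d+[m-d] = solve-∀

  coeff-at : ∀ d s i → coeff (shift d s) (d ℤ.+ i) ≡ coeffℤ s i
  coeff-at d s i = ≡.cong (coeffℤ s) (lemma d i)
    where
    lemma : ∀ d i → d ℤ.+ i ℤ.+ ℤ.- d ≡ i
    lemma = solve-∀

  coeff-below : ∀ f {m} → m ℤ.< start f → coeff f m ≡ R.0#
  coeff-below f {m} m<d with m ℤ.- start f | ℤ.i-j≤0⇒i≤j {start f} {m} ∘ neg
    where
    neg : 0ℤ ℤ.≤ m ℤ.- start f → start f ℤ.- m ℤ.≤ 0ℤ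
    neg 0≤ = ≡.subst (ℤ._≤ 0ℤ) (lemma m (start f)) (ℤ.neg-mono-≤ 0≤)
      where
      lemma : ∀ m d → ℤ.- (m ℤ.+ ℤ.- d) ≡ d ℤ.+ ℤ.- m
      lemma = solve-∀
  ... | + _      | d≤m with () ← ℤ.<⇒≱ m<d (d≤m (ℤ.+≤+ ℕ.z≤n))
  ... | -[1+ _ ] | _ = ≡.refl

  ≈-at : ∀ d {f g} → (∀ i → coeff f (d ℤ.+ i) R.≈ coeff g (d ℤ.+ i)) → f ≈ g
  ≈-at d eq m rewrite m≡d+[m-d] m d = eq (m ℤ.- d)

  ≈-setoid : Setoid c ℓ
  ≈-setoid = record
    { Carrier       = LaurentSeries
    ; _≈_           = _≈_
    ; isEquivalence = record
      { refl  = λ _ → R.refl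
      ; sym   = λ p → R.sym ∘ p
      ; trans = λ p q m → R.trans (p m) (q m)
      }
    }

  private module ≈ = Setoid ≈-setoid

  coeffℤ-cong : ∀ {s t} → s ≋ t → ∀ i → coeffℤ s i R.≈ coeffℤ t i
  coeffℤ-cong s≋t (+ j)    = s≋t j
  coeffℤ-cong s≋t -[1+ _ ] = R.refl

  shift-cong : ∀ {d e s t} → d ≡ e → s ≋ t → shift d s ≈ shift e t
  shift-cong {d} ≡.refl s≋t m = coeffℤ-cong s≋t (m ℤ.- d)

  ≈⇒series-≋ : ∀ {f g} → start f ≡ start g → f ≈ g → series f ≋ series g
  ≈⇒series-≋ {shift d s} {shift .d t} ≡.refl eq j = begin
    s j                           ≡⟨ coeff-at d s (+ j) ⟨
    coeff (shift d s) (d ℤ.+ + j) ≈⟨ eq (d ℤ.+ + j) ⟩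
    coeff (shift d t) (d ℤ.+ + j) ≡⟨ coeff-at d t (+ j) ⟩
    t j                           ∎
    where open SetoidReasoning R.setoid hiding (start)

  rebase : ∀ d f → d ℤ.≤ start f → f ≈ shift d (λ j → coeff f (d ℤ.+ + j))
  rebase d f d≤ = ≈-at d (R.reflexive ∘ lemma)
    where
    open ≡.≡-Reasoning
    s = λ j → coeff f (d ℤ.+ + j)
    below : ∀ n → d ℤ.+ -[1+ n ] ℤ.< d
    below n = ≡.subst (d ℤ.+ -[1+ n ] ℤ.<_) (ℤ.+-identityʳ d) (ℤ.+-monoʳ-< d ℤ.-<+)
    lemma : ∀ i → coeff f (d ℤ.+ i) ≡ coeff (shift d s) (d ℤ.+ i)
    lemma (+ j)    = ≡.sym (coeff-at d s (+ j))
    lemma -[1+ n ] = begin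
      coeff f (d ℤ.+ -[1+ n ])           ≡⟨ coeff-below f (ℤ.<-≤-trans (below n) d≤) ⟩
      R.0#                               ≡⟨ coeff-at d s -[1+ n ] ⟨
      coeff (shift d s) (d ℤ.+ -[1+ n ]) ∎

  shift-delay : ∀ d s → shift d s ≈ shift (ℤ.pred d) (delay s)
  shift-delay d s = ≈-at (ℤ.pred d) λ i → R.reflexive (begin
    coeff (shift d s) (ℤ.pred d ℤ.+ i)         ≡⟨ ≡.cong (coeff (shift d s)) (lemma d i) ⟩
    coeff (shift d s) (d ℤ.+ ℤ.pred i)         ≡⟨ coeff-at d s (ℤ.pred i) ⟩
    coeffℤ s (ℤ.pred i)                        ≡⟨ coeffℤ-delay i ⟨
    coeffℤ (delay s) i                         ≡⟨ coeff-at (ℤ.pred d) (delay s) i ⟨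
    coeff (shift (ℤ.pred d) (delay s)) (ℤ.pred d ℤ.+ i) ∎)
    where
    open ≡.≡-Reasoning
    lemma : ∀ d i → -1ℤ ℤ.+ d ℤ.+ i ≡ d ℤ.+ (-1ℤ ℤ.+ i)
    lemma = solve-∀
    coeffℤ-delay : ∀ i → coeffℤ (delay s) i ≡ coeffℤ s (ℤ.pred i)
    coeffℤ-delay (+ zero)  = ≡.refl
    coeffℤ-delay (+ suc _) = ≡.refl
    coeffℤ-delay -[1+ _ ]  = ≡.refl

  -- Other representatives of the same series, with `start` lowered by n. Equal series have
  -- pointwise equal underlying power series only when their starts agree, and padding makes them
  -- agree.
  delays : ℕ → LaurentSeries → LaurentSeries
  delays zero    f = f
  delays (suc n) f = delays n (shift (ℤ.pred (start f)) (delay (series f)))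

  delays-start : ∀ n f → start (delays n f) ≡ start f ℤ.- + n
  delays-start zero    f = ≡.sym (ℤ.+-identityʳ (start f))
  delays-start (suc n) f = begin
    start (delays n _)               ≡⟨ delays-start n _ ⟩
    ℤ.pred (start f) ℤ.- + n         ≡⟨ lemma (start f) (+ n) ⟩
    start f ℤ.- (+ suc n)            ∎
    where
    open ≡.≡-Reasoning
    lemma : ∀ d n → -1ℤ ℤ.+ d ℤ.+ ℤ.- n ≡ d ℤ.+ ℤ.- (1ℤ ℤ.+ n)
    lemma = solve-∀

  delays-≈ : ∀ n f → f ≈ delays n f
  delays-≈ zero    f = ≈.refl
  delays-≈ (suc n) f = ≈.trans (shift-delay (start f) (series f)) (delays-≈ n _)

  delays-* : ∀ n f g → f * g ≈ delays n f * g
  delays-* zero    f g = ≈.refl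
  delays-* (suc n) f g = begin
    f * g
      ≈⟨ shift-delay (start f ℤ.+ start g) (series f ⊛ series g) ⟩
    shift (ℤ.pred (start f ℤ.+ start g)) (delay (series f ⊛ series g))
      ≈⟨ shift-cong (ℤ.+-assoc -1ℤ (start f) (start g)) (delay-⊛ (series f) (series g)) ⟨
    shift (ℤ.pred (start f)) (delay (series f)) * g
      ≈⟨ delays-* n _ g ⟩
    delays (suc n) f * g ∎
    where open SetoidReasoning ≈-setoid hiding (start)

  *-comm : ∀ f g → f * g ≈ g * f
  *-comm f g = shift-cong (ℤ.+-comm (start f) (start g)) (⊛-comm (series f) (series g))

  private
    -- Multiplication is defined on representatives, so it has to be shown not to depend on them.
    -- Padding `f` down to the start of `f′` changes neither `f` nor the product, and afterwards the
    -- two power series coincide.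
    *-congʳ-≤ : ∀ f f′ g → start f′ ℤ.≤ start f → f ≈ f′ → f * g ≈ f′ * g
    *-congʳ-≤ f f′ g d′≤d f≈f′ = begin
      f * g          ≈⟨ delays-* n f g ⟩
      delays n f * g ≈⟨ shift-cong (≡.cong (ℤ._+ start g) start-≡)
                          (⊛-cong (≈⇒series-≋ start-≡ f″≈f′) (λ _ → R.refl)) ⟩
      f′ * g         ∎
      where
      open SetoidReasoning ≈-setoid hiding (start)
      n = ℤ.∣ start f ℤ.- start f′ ∣
      lemma : ∀ d e → d ℤ.+ ℤ.- (d ℤ.+ ℤ.- e) ≡ e
      lemma = solve-∀
      start-≡ : start (delays n f) ≡ start f′
      start-≡ = ≡.trans (delays-start n f)
        (≡.trans (≡.cong (λ i → start f ℤ.- i) (ℤ.0≤i⇒+∣i∣≡i (ℤ.i≤j⇒0≤j-i d′≤d)))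
                 (lemma (start f) (start f′)))
      f″≈f′ : delays n f ≈ f′
      f″≈f′ = ≈.trans (≈.sym (delays-≈ n f)) f≈f′

  *-congʳ : ∀ {f f′} g → f ≈ f′ → f * g ≈ f′ * g
  *-congʳ {f} {f′} g f≈f′ with ℤ.≤-total (start f′) (start f)
  ... | inj₁ d′≤d = *-congʳ-≤ f f′ g d′≤d f≈f′
  ... | inj₂ d≤d′ = ≈.sym (*-congʳ-≤ f′ f g d≤d′ (≈.sym f≈f′))

  *-cong : ∀ {f f′ g g′} → f ≈ f′ → g ≈ g′ → f * g ≈ f′ * g′
  *-cong {f} {f′} {g} {g′} f≈f′ g≈g′ = begin
    f * g   ≈⟨ *-congʳ g f≈f′ ⟩
    f′ * g  ≈⟨ *-comm f′ g ⟩
    g * f′  ≈⟨ *-congʳ f′ g≈g′ ⟩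
    g′ * f′ ≈⟨ *-comm g′ f′ ⟩
    f′ * g′ ∎
    where open SetoidReasoning ≈-setoid hiding (start)

  *-assoc : ∀ f g h → f * g * h ≈ f * (g * h)
  *-assoc f g h = shift-cong (ℤ.+-assoc (start f) (start g) (start h))
    (⊛-assoc (series f) (series g) (series h))

  coeff-0# : ∀ m → coeff 0# m R.≈ R.0#
  coeff-0# m with m ℤ.- 0ℤ
  ... | + _      = R.refl
  ... | -[1+ _ ] = R.refl

  coeff-neg : ∀ f m → coeff (- f) m R.≈ R.- coeff f m
  coeff-neg f m with m ℤ.- start f
  ... | + _      = R.refl
  ... | -[1+ _ ] = R.sym -0#≈0#

  coeff-+ : ∀ f g m → coeff (f + g) m R.≈ coeff f m R.+ coeff g m
  coeff-+ f g m rewrite m≡d+[m-d] m (start f ℤ.⊓ start g) = at (m ℤ.- d)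
    where
    d = start f ℤ.⊓ start g
    below : ∀ n → d ℤ.+ -[1+ n ] ℤ.< d
    below n = ≡.subst (d ℤ.+ -[1+ n ] ℤ.<_) (ℤ.+-identityʳ d) (ℤ.+-monoʳ-< d ℤ.-<+)
    at : ∀ i → coeff (f + g) (d ℤ.+ i) R.≈ coeff f (d ℤ.+ i) R.+ coeff g (d ℤ.+ i)
    at (+ j)    = R.reflexive (coeff-at d (series (f + g)) (+ j))
    at -[1+ n ] = begin
      coeff (f + g) (d ℤ.+ -[1+ n ])                      ≡⟨ coeff-below (f + g) (below n) ⟩
      R.0#                                                ≈⟨ R.+-identityˡ R.0# ⟨
      R.0# R.+ R.0#
        ≡⟨ ≡.cong₂ R._+_ (coeff-below f (ℤ.<-≤-trans (below n) (ℤ.i⊓j≤i (start f) (start g))))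
                         (coeff-below g (ℤ.<-≤-trans (below n) (ℤ.i⊓j≤j (start f) (start g)))) ⟨
      coeff f (d ℤ.+ -[1+ n ]) R.+ coeff g (d ℤ.+ -[1+ n ]) ∎
      where open SetoidReasoning R.setoid hiding (start)

  +-cong : ∀ {f f′ g g′} → f ≈ f′ → g ≈ g′ → f + g ≈ f′ + g′
  +-cong {f} {f′} {g} {g′} f≈f′ g≈g′ m = begin
    coeff (f + g) m             ≈⟨ coeff-+ f g m ⟩
    coeff f m R.+ coeff g m     ≈⟨ R.+-cong (f≈f′ m) (g≈g′ m) ⟩
    coeff f′ m R.+ coeff g′ m   ≈⟨ coeff-+ f′ g′ m ⟨
    coeff (f′ + g′) m           ∎
    where open SetoidReasoning R.setoid hiding (start)

  -- The sum `g + h` is formed at the common start d; once both summands are rebased to d, the claim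
  -- is distributivity of the convolution.
  *-distribʳ-+ : ∀ f g h → (g + h) * f ≈ g * f + h * f
  *-distribʳ-+ f g h = begin
    (g + h) * f                         ≈⟨ shift-cong ≡.refl (⊛-distribʳ (series f) g′ h′) ⟩
    shift e (λ j → (g′ ⊛ series f) j R.+ (h′ ⊛ series f) j)
      ≈⟨ (λ m → R.trans (shift-+ m) (R.sym (coeff-+ (shift d g′ * f) (shift d h′ * f) m))) ⟩
    shift d g′ * f + shift d h′ * f
      ≈⟨ +-cong (*-congʳ f (rebase d g (ℤ.i⊓j≤i (start g) (start h))))
                (*-congʳ f (rebase d h (ℤ.i⊓j≤j (start g) (start h)))) ⟨
    g * f + h * f                       ∎
    where
    open SetoidReasoning ≈-setoid hiding (start)
    d = start g ℤ.⊓ start h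
    e = d ℤ.+ start f
    g′ = λ j → coeff g (d ℤ.+ + j)
    h′ = λ j → coeff h (d ℤ.+ + j)
    shift-+ : ∀ {s t} m → coeff (shift e (λ j → s j R.+ t j)) m
                     R.≈ coeff (shift e s) m R.+ coeff (shift e t) m
    shift-+ m with m ℤ.- e
    ... | + _      = R.refl
    ... | -[1+ _ ] = R.sym (R.+-identityˡ R.0#)

  *-identityˡ : ∀ f → 1# * f ≈ f
  *-identityˡ f = shift-cong (ℤ.+-identityˡ (start f)) λ where
    zero    → R.trans (⊛-coeff₀ (series 1#) (series f)) (R.*-identityˡ _)
    (suc m) → R.trans (R.+-cong (R.*-identityˡ _) (⊛-zeroˡ (λ _ → R.refl) (series f) m))
                      (R.+-identityʳ _)

  commutativeRing : CommutativeRing c ℓ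
  commutativeRing = record
    { isCommutativeRing = record
      { isRing = record
        { +-isAbelianGroup = record
          { isGroup = record
            { isMonoid = record
              { isSemigroup = record
                { isMagma = record { isEquivalence = ≈.isEquivalence ; ∙-cong = +-cong }
                ; assoc   = λ f g h m → begin
                    coeff (f + g + h) m                     ≈⟨ coeff-+ (f + g) h m ⟩
                    coeff (f + g) m R.+ coeff h m           ≈⟨ R.+-congʳ (coeff-+ f g m) ⟩
                    coeff f m R.+ coeff g m R.+ coeff h m   ≈⟨ R.+-assoc _ _ _ ⟩
                    coeff f m R.+ (coeff g m R.+ coeff h m) ≈⟨ R.+-congˡ (coeff-+ g h m) ⟨
                    coeff f m R.+ coeff (g + h) m           ≈⟨ coeff-+ f (g + h) m ⟨
                    coeff (f + (g + h)) m                   ∎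
                }
              ; identity = comm∧idˡ⇒id +-comm {0#} λ f m → begin
                  coeff (0# + f) m         ≈⟨ coeff-+ 0# f m ⟩
                  coeff 0# m R.+ coeff f m ≈⟨ R.+-congʳ (coeff-0# m) ⟩
                  R.0# R.+ coeff f m       ≈⟨ R.+-identityˡ _ ⟩
                  coeff f m                ∎
              }
            ; inverse = comm∧invˡ⇒inv {e = 0#} +-comm λ f m → begin
                coeff (- f + f) m           ≈⟨ coeff-+ (- f) f m ⟩
                coeff (- f) m R.+ coeff f m ≈⟨ R.+-congʳ (coeff-neg f m) ⟩
                R.- coeff f m R.+ coeff f m ≈⟨ R.-‿inverseˡ _ ⟩
                R.0#                        ≈⟨ coeff-0# m ⟨
                coeff 0# m                  ∎
            ; ⁻¹-cong = λ {f} {g} f≈g m → begin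
                coeff (- f) m ≈⟨ coeff-neg f m ⟩
                R.- coeff f m ≈⟨ R.-‿cong (f≈g m) ⟩
                R.- coeff g m ≈⟨ coeff-neg g m ⟨
                coeff (- g) m ∎
            }
          ; comm = +-comm
          }
        ; *-cong     = *-cong
        ; *-assoc    = *-assoc
        ; *-identity = comm∧idˡ⇒id *-comm {1#} *-identityˡ
        ; distrib    = comm∧distrʳ⇒distr +-cong *-comm *-distribʳ-+
        }
      ; *-comm = *-comm
      }
    }
    where
    open Consequences ≈-setoid
    open SetoidReasoning R.setoid hiding (start)
    +-comm : ∀ f g → f + g ≈ g + f
    +-comm f g m = begin
      coeff (f + g) m         ≈⟨ coeff-+ f g m ⟩
      coeff f m R.+ coeff g m ≈⟨ R.+-comm _ _ ⟩
      coeff g m R.+ coeff f m ≈⟨ coeff-+ g f m ⟨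
      coeff (g + f) m         ∎

-- Parity of exponents; integral and even series as subrings

even⊎odd : ∀ m → (∃[ k ] m ≡ + 2 ℤ.* k) ⊎ (∃[ k ] m ≡ + 2 ℤ.* k ℤ.+ 1ℤ)
even⊎odd m with m ℤ.%ℕ 2 | ℤ.n%ℕd<d m 2 | ℤ.a≡a%ℕn+[a/ℕn]*n m 2
... | 0 | _ | eq = inj₁ (m ℤ./ℕ 2 , ≡.trans eq (lemma (m ℤ./ℕ 2)))
  where
  lemma : ∀ k → + 0 ℤ.+ k ℤ.* + 2 ≡ + 2 ℤ.* k
  lemma = solve-∀
... | 1 | _ | eq = inj₂ (m ℤ./ℕ 2 , ≡.trans eq (lemma (m ℤ./ℕ 2)))
  where
  lemma : ∀ k → + 1 ℤ.+ k ℤ.* + 2 ≡ + 2 ℤ.* k ℤ.+ 1ℤ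
  lemma = solve-∀
... | suc (suc _) | s≤s (s≤s ()) | _

-- The two alternatives match the two clauses of `coeffℤ`: an odd exponent selects either an odd
-- coefficient of the power series or the default zero.
odd-form : ∀ k → (∃[ n ] + 2 ℤ.* k ℤ.+ 1ℤ ≡ + suc (n ℕ.* 2)) ⊎
                 (∃[ n ] + 2 ℤ.* k ℤ.+ 1ℤ ≡ -[1+ n ])
odd-form (+ n)    = inj₁ (n , ≡.trans (lemma (+ n)) (≡.cong (λ i → 1ℤ ℤ.+ i) (≡.sym (ℤ.pos-* n 2))))
  where
  lemma : ∀ k → + 2 ℤ.* k ℤ.+ 1ℤ ≡ 1ℤ ℤ.+ k ℤ.* + 2
  lemma = solve-∀
odd-form -[1+ n ] = inj₂ (n ℕ.+ n , lemma (+ n))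
  where
  lemma : ∀ k → + 2 ℤ.* (ℤ.- (1ℤ ℤ.+ k)) ℤ.+ 1ℤ ≡ ℤ.- (1ℤ ℤ.+ (k ℤ.+ k))
  lemma = solve-∀

odd≢0 : ∀ k → + 2 ℤ.* k ℤ.+ 1ℤ ≢ 0ℤ
odd≢0 k 2k+1≡0 with odd-form k
... | inj₁ (_ , 2k+1≡) = contradiction (≡.trans (≡.sym 2k+1≡) 2k+1≡0) λ ()
... | inj₂ (_ , 2k+1≡) = contradiction (≡.trans (≡.sym 2k+1≡) 2k+1≡0) λ ()

record IsSubring {c ℓ p} (R : CommutativeRing c ℓ)
                 (P : Pred (CommutativeRing.Carrier R) p) : Set (c ⊔ ℓ ⊔ p) where
  open CommutativeRing R
  field
    resp    : ∀ {x y} → x ≈ y → x ∈ P → y ∈ P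
    0#∈     : 0# ∈ P
    1#∈     : 1# ∈ P
    +-closed : ∀ {x y} → x ∈ P → y ∈ P → x + y ∈ P
    *-closed : ∀ {x y} → x ∈ P → y ∈ P → x * y ∈ P
    -‿closed : ∀ {x} → x ∈ P → - x ∈ P

module LaurentSubrings {c ℓ} (R : CommutativeRing c ℓ) where
  private
    module R = CommutativeRing R
  open RingProperties R.ring using (-0#≈0#)
  open PowerSeriesProperties R
  open Laurent R
  open LaurentSeries
  open LaurentProperties R
  open SetoidReasoning R.setoid hiding (start)

  -- `z^ d` and `1#` have the same underlying power series, so the product differs from `1# * f`
  -- only in its start.
  coeff-z^* : ∀ d f m → coeff (z^ d * f) m R.≈ coeff f (m ℤ.- d)
  coeff-z^* d f m = begin
    coeff (z^ d * f) m
      ≈⟨ shift-cong {d = d ℤ.+ start f} ≡.refl (≈⇒series-≋ {1# * f} {f} (ℤ.+-identityˡ _) (*-identityˡ f)) m ⟩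
    coeff (shift (d ℤ.+ start f) (series f)) m
      ≡⟨ ≡.cong (coeffℤ (series f)) (lemma m d (start f)) ⟩
    coeff f (m ℤ.- d) ∎
    where
    lemma : ∀ m d e → m ℤ.+ ℤ.- (d ℤ.+ e) ≡ m ℤ.+ ℤ.- d ℤ.+ ℤ.- e
    lemma = solve-∀

  z^-+ : ∀ d e → z^ (d ℤ.+ e) ≈ z^ d * z^ e
  z^-+ d e =
    shift-cong {d = d ℤ.+ e} ≡.refl λ m →
      R.sym (≈⇒series-≋ {1# * z^ e} {z^ e} (ℤ.+-identityˡ _) (*-identityˡ (z^ e)) m)

  coeff-z^ : ∀ d m → m ≢ d → coeff (z^ d) m R.≈ R.0#
  coeff-z^ d m m≢d with m ℤ.- d | ℤ.i-j≡0⇒i≡j m d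
  ... | + zero   | eq = contradiction (eq ≡.refl) m≢d
  ... | + suc _  | _ = R.refl
  ... | -[1+ _ ] | _ = R.refl

  -- For integral f this is f again, with start 0. The product of two such representatives also
  -- starts at 0, which gives both closure under products and multiplicativity of the constant term.
  truncate : LaurentSeries → LaurentSeries
  truncate f = shift 0ℤ (coeff f ∘ +_)

  integral-form : ∀ f → f ∈ Integral → f ≈ truncate f
  integral-form f p = ≈-at 0ℤ {f} {truncate f} λ where
    (+ j)    → R.reflexive (≡.sym (coeff-at 0ℤ (coeff f ∘ +_) (+ j)))
    -[1+ n ] → p -[1+ n ] ℤ.-<+

  Integral-isSubring : IsSubring commutativeRing Integral
  Integral-isSubring = record
    { resp     = λ f≈g p m m<0 → R.trans (R.sym (f≈g m)) (p m m<0)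
    ; 0#∈      = λ m _ → coeff-0# m
    ; 1#∈      = λ m m<0 → R.reflexive (coeff-below 1# m<0)
    ; +-closed = λ {f} {g} p q m m<0 → R.trans (coeff-+ f g m)
        (R.trans (R.+-cong (p m m<0) (q m m<0)) (R.+-identityˡ R.0#))
    ; *-closed = λ {f} {g} p q m m<0 → R.trans
        (*-cong {f} {truncate f} {g} {truncate g} (integral-form f p) (integral-form g q) m)
        (R.reflexive (coeff-below (truncate f * truncate g) m<0))
    ; -‿closed = λ {f} p m m<0 → R.trans (coeff-neg f m) (R.trans (R.-‿cong (p m m<0)) -0#≈0#)
    }

  z^-integral : ∀ n → z^ (+ n) ∈ Integral
  z^-integral n m m<0 = R.reflexive (coeff-below (z^ (+ n)) (ℤ.<-≤-trans m<0 (ℤ.+≤+ z≤n)))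

  constantTerm : LaurentSeries → R.Carrier
  constantTerm f = coeff f 0ℤ

  constantTerm-* : ∀ {f g} → f ∈ Integral → g ∈ Integral →
                   constantTerm (f * g) R.≈ constantTerm f R.* constantTerm g
  constantTerm-* {f} {g} p q = R.trans
    (*-cong {f} {truncate f} {g} {truncate g} (integral-form f p) (integral-form g q) 0ℤ)
    (⊛-coeff₀ (coeff f ∘ +_) (coeff g ∘ +_))

  private
    EvenPowers : PowerSeries → Set _
    EvenPowers s = ∀ n → s (suc (n ℕ.* 2)) R.≈ R.0#

    0+0≈0 : ∀ {a b} → a R.≈ R.0# → b R.≈ R.0# → a R.+ b R.≈ R.0#
    0+0≈0 a≈0 b≈0 = R.trans (R.+-cong a≈0 b≈0) (R.+-identityˡ R.0#)

    a*0≈0 : ∀ a {b} → b R.≈ R.0# → a R.* b R.≈ R.0#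
    a*0≈0 a b≈0 = R.trans (R.*-congˡ b≈0) (R.zeroʳ a)

    0*b≈0 : ∀ {a} b → a R.≈ R.0# → a R.* b R.≈ R.0#
    0*b≈0 b a≈0 = R.trans (R.*-congʳ a≈0) (R.zeroˡ b)

    -- Induction in steps of two: split off the terms of s₀ and s₁. The first meets an odd
    -- coefficient of `t`, in the second s₁ itself vanishes, and s without its first two
    -- coefficients is again even.
    ⊛-evenPowers : ∀ s t → EvenPowers s → EvenPowers t → EvenPowers (s ⊛ t)
    ⊛-evenPowers s t p q zero    =
      0+0≈0 (a*0≈0 (s 0) (q 0)) (0+0≈0 (0*b≈0 (t 0) (p 0)) R.refl)
    ⊛-evenPowers s t p q (suc n) =
      0+0≈0 (a*0≈0 (s 0) (q (suc n)))
        (0+0≈0 (0*b≈0 (t (suc (suc (n ℕ.* 2)))) (p 0)) (⊛-evenPowers (λ j → s (suc (suc j))) t (p ∘ suc) q n))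

    coeffℤ-odd : ∀ {s} → EvenPowers s → ∀ k → coeffℤ s (+ 2 ℤ.* k ℤ.+ 1ℤ) R.≈ R.0#
    coeffℤ-odd {s} p k with + 2 ℤ.* k ℤ.+ 1ℤ | odd-form k
    ... | _ | inj₁ (n , ≡.refl) = p n
    ... | _ | inj₂ (_ , ≡.refl) = R.refl

  shift-even : ∀ d {s} → EvenPowers s → shift (+ 2 ℤ.* d) s ∈ Even
  shift-even d {s} p m =
    R.trans (R.reflexive (≡.cong (coeffℤ s) (lemma m d))) (coeffℤ-odd {s} p (m ℤ.- d))
    where
    lemma : ∀ m d → + 2 ℤ.* m ℤ.+ 1ℤ ℤ.+ ℤ.- (+ 2 ℤ.* d) ≡ + 2 ℤ.* (m ℤ.+ ℤ.- d) ℤ.+ 1ℤ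
    lemma = solve-∀

  private
    even-form : ∀ f → f ∈ Even → ∃[ d ] ∃[ s ] EvenPowers s × f ≈ shift (+ 2 ℤ.* d) s
    even-form f p = d , s , s-even , rebase (+ 2 ℤ.* d) f 2d≤
      where
      -- A representative with even start is wanted, not above the given one; -2|e| ≤ e holds for
      -- every integer e.
      d = ℤ.- + ℤ.∣ start f ∣
      s : PowerSeries
      s j = coeff f (+ 2 ℤ.* d ℤ.+ + j)
      lemma : ∀ d n → + 2 ℤ.* d ℤ.+ (1ℤ ℤ.+ n ℤ.* + 2) ≡ + 2 ℤ.* (d ℤ.+ n) ℤ.+ 1ℤ
      lemma = solve-∀
      s-even : EvenPowers s
      s-even n = R.trans (R.reflexive (≡.cong (coeff f) (≡.trans
        (≡.cong (λ i → + 2 ℤ.* d ℤ.+ (1ℤ ℤ.+ i)) (ℤ.pos-* n 2)) (lemma d (+ n)))))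
        (p (d ℤ.+ + n))
      2d≤ : + 2 ℤ.* d ℤ.≤ start f
      2d≤ = bound (start f)
        where
        bound : ∀ e → + 2 ℤ.* (ℤ.- + ℤ.∣ e ∣) ℤ.≤ e
        bound (+ zero) = ℤ.≤-refl
        bound (+ suc _) = ℤ.-≤+
        bound -[1+ n ] = ℤ.-≤- (ℕ.m≤m+n n _)

  Even-isSubring : IsSubring commutativeRing Even
  Even-isSubring = record
    { resp     = λ f≈g p m → R.trans (R.sym (f≈g (+ 2 ℤ.* m ℤ.+ 1ℤ))) (p m)
    ; 0#∈      = λ m → coeff-0# (+ 2 ℤ.* m ℤ.+ 1ℤ)
    ; 1#∈      = shift-even 0ℤ (λ _ → R.refl)
    ; +-closed = λ {f} {g} p q m → R.trans (coeff-+ f g (+ 2 ℤ.* m ℤ.+ 1ℤ)) (0+0≈0 (p m) (q m))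
    ; *-closed = *-closed
    ; -‿closed = λ {f} p m → R.trans (coeff-neg f (+ 2 ℤ.* m ℤ.+ 1ℤ)) (R.trans (R.-‿cong (p m)) -0#≈0#)
    }
    where
    *-closed : ∀ {f g} → f ∈ Even → g ∈ Even → f * g ∈ Even
    *-closed {f} {g} p q m with even-form f p | even-form g q
    ... | d , s , s-even , f≈ | e , t , t-even , g≈ = begin
      coeff (f * g) (+ 2 ℤ.* m ℤ.+ 1ℤ)
        ≈⟨ *-cong f≈ g≈ (+ 2 ℤ.* m ℤ.+ 1ℤ) ⟩
      coeff (shift (+ 2 ℤ.* d ℤ.+ + 2 ℤ.* e) (s ⊛ t)) (+ 2 ℤ.* m ℤ.+ 1ℤ)
        ≡⟨ ≡.cong (λ a → coeff (shift a (s ⊛ t)) (+ 2 ℤ.* m ℤ.+ 1ℤ)) (ℤ.*-distribˡ-+ (+ 2) d e) ⟨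
      coeff (shift (+ 2 ℤ.* (d ℤ.+ e)) (s ⊛ t)) (+ 2 ℤ.* m ℤ.+ 1ℤ)
        ≈⟨ shift-even (d ℤ.+ e) {s ⊛ t} (⊛-evenPowers s t s-even t-even) m ⟩
      R.0# ∎

  z^-even : ∀ k → z^ (+ 2 ℤ.* k) ∈ Even
  z^-even k = shift-even k (λ _ → R.refl)

-- R((z)) with operations that do not unfold, so that unification can recover
-- the factors of a product.
record LaurentRing {c ℓ} (R : CommutativeRing c ℓ) : Set (lsuc (c ⊔ ℓ)) where
  private module R = CommutativeRing R
  field
    commutativeRing : CommutativeRing c ℓ
  open CommutativeRing commutativeRing
  infix 9 z^_
  field
    coeff : Carrier → ℤ → R.Carrier
    z^_   : ℤ → Carrier

  Integral : Pred Carrier ℓ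
  Integral f = ∀ m → m ℤ.< 0ℤ → coeff f m R.≈ R.0#

  Even : Pred Carrier ℓ
  Even f = ∀ m → coeff f (+ 2 ℤ.* m ℤ.+ 1ℤ) R.≈ R.0#

  constantTerm : Carrier → R.Carrier
  constantTerm f = coeff f 0ℤ

  field
    coeff-cong         : ∀ {f g} → f ≈ g → ∀ m → coeff f m R.≈ coeff g m
    coeff-0#           : ∀ m → coeff 0# m R.≈ R.0#
    coeff-+            : ∀ f g m → coeff (f + g) m R.≈ coeff f m R.+ coeff g m
    coeff-neg          : ∀ f m → coeff (- f) m R.≈ R.- coeff f m
    coeff-z^*          : ∀ d f m → coeff (z^ d * f) m R.≈ coeff f (m ℤ.- d)
    coeff-z^           : ∀ d m → m ≢ d → coeff (z^ d) m R.≈ R.0#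
    constantTerm-1#    : constantTerm 1# R.≈ R.1#
    constantTerm-*     : ∀ {f g} → Integral f → Integral g →
                         constantTerm (f * g) R.≈ constantTerm f R.* constantTerm g
    z^-0               : z^ 0ℤ ≈ 1#
    z^-+               : ∀ d e → z^ (d ℤ.+ e) ≈ z^ d * z^ e
    z^-integral        : ∀ n → Integral (z^ (+ n))
    z^-even            : ∀ k → Even (z^ (+ 2 ℤ.* k))
    Integral-isSubring : IsSubring commutativeRing Integral
    Even-isSubring     : IsSubring commutativeRing Even

laurentRing : ∀ {c ℓ} (R : CommutativeRing c ℓ) → LaurentRing R
laurentRing R = record
  { commutativeRing    = commutativeRing
  ; coeff              = coeff
  ; z^_                = z^_
  ; coeff-cong         = id
  ; coeff-0#           = coeff-0#
  ; coeff-+            = coeff-+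
  ; coeff-neg          = coeff-neg
  ; coeff-z^*          = coeff-z^*
  ; coeff-z^           = coeff-z^
  ; constantTerm-1#    = CommutativeRing.refl R
  ; constantTerm-*     = λ {f} {g} → constantTerm-* {f} {g}
  ; z^-0               = λ _ → CommutativeRing.refl R
  ; z^-+               = z^-+
  ; z^-integral        = z^-integral
  ; z^-even            = z^-even
  ; Integral-isSubring = Integral-isSubring
  ; Even-isSubring     = Even-isSubring
  }
  where
  open Laurent R
  open LaurentProperties R
  open LaurentSubrings R

-- Matrices and row vectors over a commutative ring

module MatrixProperties {c ℓ} (R : CommutativeRing c ℓ) where
  open CommutativeRing R
  open SemiringSum semiring public
    using (sum; sum-cong-≋; ∑-distrib-+; ∑-comm; *-distribˡ-sum; *-distribʳ-sum; sum-replicate-zero)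
  open Matrices rawRing
  open SetoidReasoning setoid

  infix  4 _≈ᵛ_
  infixl 7 _ᵛ*ᴹ_
  infixl 6 _+ᵛ_
  infixr 7 _*ᵛ_
  infix  9 _ᵀ

  _≈ᵛ_ : ∀ {n} → Vector Carrier n → Vector Carrier n → Set ℓ
  x ≈ᵛ y = ∀ i → x i ≈ y i

  _+ᵛ_ : ∀ {n} → Vector Carrier n → Vector Carrier n → Vector Carrier n
  (x +ᵛ y) i = x i + y i

  _*ᵛ_ : ∀ {n} → Carrier → Vector Carrier n → Vector Carrier n
  (a *ᵛ x) i = a * x i

  _ᵛ*ᴹ_ : ∀ {n} → Vector Carrier n → Matrix n → Vector Carrier n
  (x ᵛ*ᴹ M) j = sum (λ k → x k * M k j)

  _ᵀ : ∀ {n} → Matrix n → Matrix n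
  M ᵀ = flip M

  sum-≈0 : ∀ {n} {x : Vector Carrier n} → (∀ i → x i ≈ 0#) → sum x ≈ 0#
  sum-≈0 {n} {x} x≈0 = trans (sum-cong-≋ {n} {x} {replicate n 0#} x≈0) (sum-replicate-zero n)

  sum-↑ : ∀ m {n} (x : Vector Carrier (m ℕ.+ n)) →
          sum x ≈ sum (λ i → x (i ↑ˡ n)) + sum (λ i → x (m ↑ʳ i))
  sum-↑ zero    x = sym (+-identityˡ _)
  sum-↑ (suc m) x = trans (+-congˡ (sum-↑ m (x ∘ Fin.suc))) (sym (+-assoc _ _ _))

  -- Interchange of the two summations. The associativity laws for vectors and matrices below are
  -- read off from it.
  dot-assoc : ∀ {m n} (x : Vector Carrier m) (M : Fin m → Fin n → Carrier) (y : Vector Carrier n) →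
              sum (λ k → sum (λ j → x j * M j k) * y k) ≈ sum (λ j → x j * sum (λ k → M j k * y k))
  dot-assoc x M y = begin
    sum (λ k → sum (λ j → x j * M j k) * y k)
      ≈⟨ sum-cong-≋ (λ k → *-distribʳ-sum (y k) (λ j → x j * M j k)) ⟩
    sum (λ k → sum (λ j → x j * M j k * y k))
      ≈⟨ ∑-comm (λ k j → x j * M j k * y k) ⟩
    sum (λ j → sum (λ k → x j * M j k * y k))
      ≈⟨ sum-cong-≋ (λ j → sum-cong-≋ (λ k → *-assoc (x j) (M j k) (y k))) ⟩
    sum (λ j → sum (λ k → x j * (M j k * y k)))
      ≈⟨ sum-cong-≋ (λ j → *-distribˡ-sum (x j) (λ k → M j k * y k)) ⟨
    sum (λ j → x j * sum (λ k → M j k * y k)) ∎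

  ᵛ*ᴹ-cong : ∀ {n} {x y : Vector Carrier n} {M N : Matrix n} → x ≈ᵛ y → M ≈ᴹ N → x ᵛ*ᴹ M ≈ᵛ y ᵛ*ᴹ N
  ᵛ*ᴹ-cong x≈y M≈N j = sum-cong-≋ (λ k → *-cong (x≈y k) (M≈N k j))

  ᵛ*ᴹ-assoc : ∀ {n} (x : Vector Carrier n) (M N : Matrix n) → x ᵛ*ᴹ M ᵛ*ᴹ N ≈ᵛ x ᵛ*ᴹ (M *ᴹ N)
  ᵛ*ᴹ-assoc x M N j = dot-assoc x M (λ k → N k j)

  ᵛ*ᴹ-+ : ∀ {n} (x y : Vector Carrier n) (M : Matrix n) → (x +ᵛ y) ᵛ*ᴹ M ≈ᵛ x ᵛ*ᴹ M +ᵛ y ᵛ*ᴹ M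
  ᵛ*ᴹ-+ x y M j = trans (sum-cong-≋ (λ k → distribʳ (M k j) (x k) (y k)))
                        (∑-distrib-+ (λ k → x k * M k j) (λ k → y k * M k j))

  ᵛ*ᴹ-* : ∀ {n} a (x : Vector Carrier n) (M : Matrix n) → (a *ᵛ x) ᵛ*ᴹ M ≈ᵛ a *ᵛ (x ᵛ*ᴹ M)
  ᵛ*ᴹ-* a x M j = trans (sum-cong-≋ (λ k → *-assoc a (x k) (M k j)))
                        (sym (*-distribˡ-sum a (λ k → x k * M k j)))

  ᵛ*ᴹ-zero : ∀ {n} {x : Vector Carrier n} → (∀ i → x i ≈ 0#) → ∀ (M : Matrix n) j → (x ᵛ*ᴹ M) j ≈ 0#
  ᵛ*ᴹ-zero x≈0 M j = sum-≈0 (λ k → trans (*-congʳ (x≈0 k)) (zeroˡ (M k j)))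

  ᵛ*ᴹ-diag : ∀ {n} (x d : Vector Carrier n) j → (x ᵛ*ᴹ diag d) j ≈ x j * d j
  ᵛ*ᴹ-diag x d Fin.zero    = trans (+-congˡ (sum-≈0 (λ k → zeroʳ (x (Fin.suc k))))) (+-identityʳ _)
  ᵛ*ᴹ-diag x d (Fin.suc j) = trans (+-congʳ (zeroʳ _))
    (trans (+-identityˡ _) (ᵛ*ᴹ-diag (x ∘ Fin.suc) (d ∘ Fin.suc) j))

  ᵛ*ᴹ-1ᴹ : ∀ {n} (x : Vector Carrier n) → x ᵛ*ᴹ 1ᴹ ≈ᵛ x
  ᵛ*ᴹ-1ᴹ x j = trans (ᵛ*ᴹ-diag x (λ _ → 1#) j) (*-identityʳ (x j))

  diag-ᵀ : ∀ {n} (d : Vector Carrier n) i j → (diag d ᵀ) i j ≡ diag d i j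
  diag-ᵀ d Fin.zero    Fin.zero    = ≡.refl
  diag-ᵀ d Fin.zero    (Fin.suc j) = ≡.refl
  diag-ᵀ d (Fin.suc i) Fin.zero    = ≡.refl
  diag-ᵀ d (Fin.suc i) (Fin.suc j) = diag-ᵀ (d ∘ Fin.suc) i j

  1ᴹ-diagonal : ∀ {n} (i : Fin n) → 1ᴹ i i ≡ 1#
  1ᴹ-diagonal Fin.zero    = ≡.refl
  1ᴹ-diagonal (Fin.suc i) = 1ᴹ-diagonal i

  1ᴹ-offDiagonal : ∀ {n} (i j : Fin n) → i ≢ j → 1ᴹ i j ≡ 0#
  1ᴹ-offDiagonal Fin.zero    Fin.zero    i≢j = contradiction ≡.refl i≢j
  1ᴹ-offDiagonal Fin.zero    (Fin.suc j) i≢j = ≡.refl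
  1ᴹ-offDiagonal (Fin.suc i) Fin.zero    i≢j = ≡.refl
  1ᴹ-offDiagonal (Fin.suc i) (Fin.suc j) i≢j = 1ᴹ-offDiagonal i j (i≢j ∘ ≡.cong Fin.suc)

  *ᴹ-ᵀ : ∀ {n} (M N : Matrix n) → (M *ᴹ N) ᵀ ≈ᴹ N ᵀ *ᴹ M ᵀ
  *ᴹ-ᵀ M N i j = sum-cong-≋ (λ k → *-comm (M j k) (N k i))

  *ᴹ-cong : ∀ {n} {M M′ N N′ : Matrix n} → M ≈ᴹ M′ → N ≈ᴹ N′ → M *ᴹ N ≈ᴹ M′ *ᴹ N′
  *ᴹ-cong M≈ N≈ i = ᵛ*ᴹ-cong (M≈ i) N≈

  *ᴹ-assoc : ∀ {n} (L M N : Matrix n) → L *ᴹ M *ᴹ N ≈ᴹ L *ᴹ (M *ᴹ N)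
  *ᴹ-assoc L M N i = ᵛ*ᴹ-assoc (L i) M N

  *ᴹ-identityʳ : ∀ {n} (M : Matrix n) → M *ᴹ 1ᴹ ≈ᴹ M
  *ᴹ-identityʳ M i = ᵛ*ᴹ-1ᴹ (M i)

  *ᴹ-identityˡ : ∀ {n} (M : Matrix n) → 1ᴹ *ᴹ M ≈ᴹ M
  *ᴹ-identityˡ M i j = begin
    (1ᴹ *ᴹ M) i j        ≈⟨ *ᴹ-ᵀ 1ᴹ M j i ⟩
    (M ᵀ *ᴹ 1ᴹ ᵀ) j i    ≈⟨ ᵛ*ᴹ-cong {x = (M ᵀ) j} (λ _ → refl) (λ k l → reflexive (diag-ᵀ (λ _ → 1#) k l)) i ⟩
    (M ᵀ *ᴹ 1ᴹ) j i      ≈⟨ ᵛ*ᴹ-1ᴹ ((M ᵀ) j) i ⟩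
    M i j                ∎

  ⊕-↑ˡ↑ˡ : ∀ {m n} (M : Matrix m) (N : Matrix n) i j → (M ⊕ N) (i ↑ˡ n) (j ↑ˡ n) ≡ M i j
  ⊕-↑ˡ↑ˡ {m} {n} M N i j rewrite Fin.splitAt-↑ˡ m i n | Fin.splitAt-↑ˡ m j n = ≡.refl

  ⊕-↑ˡ↑ʳ : ∀ {m n} (M : Matrix m) (N : Matrix n) i j → (M ⊕ N) (i ↑ˡ n) (m ↑ʳ j) ≡ 0#
  ⊕-↑ˡ↑ʳ {m} {n} M N i j rewrite Fin.splitAt-↑ˡ m i n | Fin.splitAt-↑ʳ m n j = ≡.refl

  ⊕-↑ʳ↑ˡ : ∀ {m n} (M : Matrix m) (N : Matrix n) i j → (M ⊕ N) (m ↑ʳ i) (j ↑ˡ n) ≡ 0#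
  ⊕-↑ʳ↑ˡ {m} {n} M N i j rewrite Fin.splitAt-↑ʳ m n i | Fin.splitAt-↑ˡ m j n = ≡.refl

  ⊕-↑ʳ↑ʳ : ∀ {m n} (M : Matrix m) (N : Matrix n) i j → (M ⊕ N) (m ↑ʳ i) (m ↑ʳ j) ≡ N i j
  ⊕-↑ʳ↑ʳ {m} {n} M N i j rewrite Fin.splitAt-↑ʳ m n i | Fin.splitAt-↑ʳ m n j = ≡.refl

  ⊕-ᵀ : ∀ {m n} (M : Matrix m) (N : Matrix n) i j → ((M ⊕ N) ᵀ) i j ≡ (M ᵀ ⊕ N ᵀ) i j
  ⊕-ᵀ {m} M N i j with splitAt m i | splitAt m j
  ... | inj₁ _ | inj₁ _ = ≡.refl
  ... | inj₁ _ | inj₂ _ = ≡.refl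
  ... | inj₂ _ | inj₁ _ = ≡.refl
  ... | inj₂ _ | inj₂ _ = ≡.refl

  ᵛ*ᴹ-⊕-↑ˡ : ∀ {m n} (x : Vector Carrier (m ℕ.+ n)) (M : Matrix m) (N : Matrix n) j →
             (x ᵛ*ᴹ (M ⊕ N)) (j ↑ˡ n) ≈ ((λ i → x (i ↑ˡ n)) ᵛ*ᴹ M) j
  ᵛ*ᴹ-⊕-↑ˡ {m} {n} x M N j = begin
    (x ᵛ*ᴹ (M ⊕ N)) (j ↑ˡ n)
      ≈⟨ sum-↑ m _ ⟩
    sum (λ i → x (i ↑ˡ n) * (M ⊕ N) (i ↑ˡ n) (j ↑ˡ n)) + sum (λ i → x (m ↑ʳ i) * (M ⊕ N) (m ↑ʳ i) (j ↑ˡ n))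
      ≈⟨ +-cong (sum-cong-≋ {m} (λ i → *-congˡ (reflexive (⊕-↑ˡ↑ˡ M N i j))))
                (sum-≈0 {n} (λ i → trans (*-congˡ (reflexive (⊕-↑ʳ↑ˡ M N i j))) (zeroʳ _))) ⟩
    ((λ i → x (i ↑ˡ n)) ᵛ*ᴹ M) j + 0#
      ≈⟨ +-identityʳ _ ⟩
    ((λ i → x (i ↑ˡ n)) ᵛ*ᴹ M) j ∎

  ᵛ*ᴹ-⊕-↑ʳ : ∀ {m n} (x : Vector Carrier (m ℕ.+ n)) (M : Matrix m) (N : Matrix n) j →
             (x ᵛ*ᴹ (M ⊕ N)) (m ↑ʳ j) ≈ ((λ i → x (m ↑ʳ i)) ᵛ*ᴹ N) j
  ᵛ*ᴹ-⊕-↑ʳ {m} {n} x M N j = begin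
    (x ᵛ*ᴹ (M ⊕ N)) (m ↑ʳ j)
      ≈⟨ sum-↑ m _ ⟩
    sum (λ i → x (i ↑ˡ n) * (M ⊕ N) (i ↑ˡ n) (m ↑ʳ j)) + sum (λ i → x (m ↑ʳ i) * (M ⊕ N) (m ↑ʳ i) (m ↑ʳ j))
      ≈⟨ +-cong (sum-≈0 {m} (λ i → trans (*-congˡ (reflexive (⊕-↑ˡ↑ʳ M N i j))) (zeroʳ _)))
                (sum-cong-≋ {n} (λ i → *-congˡ (reflexive (⊕-↑ʳ↑ʳ M N i j)))) ⟩
    0# + ((λ i → x (m ↑ʳ i)) ᵛ*ᴹ N) j
      ≈⟨ +-identityˡ _ ⟩
    ((λ i → x (m ↑ʳ i)) ᵛ*ᴹ N) j ∎

  module _ {p} {P : Pred Carrier p} (P-isSubring : IsSubring R P) where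
    open IsSubring P-isSubring

    sum-closed : ∀ {n} {x : Vector Carrier n} → (∀ i → x i ∈ P) → sum x ∈ P
    sum-closed {zero}  x∈P = 0#∈
    sum-closed {suc n} x∈P = +-closed (x∈P Fin.zero) (sum-closed (x∈P ∘ Fin.suc))

    ᵛ*ᴹ-closed : ∀ {n} {x : Vector Carrier n} {M : Matrix n} →
                 (∀ i → x i ∈ P) → (∀ i j → M i j ∈ P) → ∀ j → (x ᵛ*ᴹ M) j ∈ P
    ᵛ*ᴹ-closed x∈P M∈P j = sum-closed (λ k → *-closed (x∈P k) (M∈P k j))

-- Linear systems over a field

record IsDiscreteField {c ℓ} (R : CommutativeRing c ℓ) : Set (c ⊔ ℓ) where
  open CommutativeRing R
  field
    1≉0       : ¬ 1# ≈ 0#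
    zero⊎unit : ∀ x → x ≈ 0# ⊎ (∃[ y ] x * y ≈ 1#)

module LinearSystems {c ℓ} (R : CommutativeRing c ℓ) (isField : IsDiscreteField R) where
  open CommutativeRing R hiding (zero)
  open IsDiscreteField isField
  open RingProperties ring using (-‿distribˡ-*; x∙y⁻¹≈ε⇒x≈y; -‿distribʳ-*)
  open MatrixProperties R
  open Matrices rawRing
  open SetoidReasoning setoid

  zeros⊎unit : ∀ {n} (x : Vector Carrier n) →
               (∀ i → x i ≈ 0#) ⊎ (Σ[ i ∈ Fin n ] ∃[ y ] x i * y ≈ 1#)
  zeros⊎unit {zero}  x = inj₁ λ ()
  zeros⊎unit {suc n} x with zero⊎unit (x zero) | zeros⊎unit (x ∘ suc)
  ... | inj₂ unit | _               = inj₂ (zero , unit)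
  ... | inj₁ _    | inj₂ (i , unit) = inj₂ (suc i , unit)
  ... | inj₁ x₀≈0 | inj₁ x≈0        = inj₁ λ { zero → x₀≈0 ; (suc i) → x≈0 i }

  -- Gaussian elimination of the first unknown. If its column vanishes, the first unit vector is a
  -- solution; otherwise a pivot row p clears it from the other equations, which are one fewer in
  -- one unknown less.
  nontrivialSolution : ∀ {m} (M : Fin m → Fin (suc m) → Carrier) →
    Σ[ x ∈ Vector Carrier (suc m) ]
      (∀ s → sum (λ r → x r * M s r) ≈ 0#) × Σ[ r ∈ Fin (suc m) ] ¬ x r ≈ 0#
  nontrivialSolution {zero}  M = (λ _ → 1#) , (λ ()) , zero , 1≉0
  nontrivialSolution {suc m} M with zeros⊎unit (λ s → M s zero)
  ... | inj₁ M₀≈0 = 1# ∷ replicate _ 0# , solves , zero , 1≉0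
    where
    solves : ∀ s → 1# * M s zero + sum (λ r → 0# * M s (suc r)) ≈ 0#
    solves s = begin
      1# * M s zero + sum (λ r → 0# * M s (suc r))
        ≈⟨ +-cong (trans (*-identityˡ _) (M₀≈0 s)) (sum-≈0 (λ r → zeroˡ (M s (suc r)))) ⟩
      0# + 0# ≈⟨ +-identityˡ 0# ⟩
      0#      ∎
  ... | inj₂ (p , y , Mₚy≈1) with nontrivialSolution (λ t r →
            M (punchIn p t) (suc r) - M (punchIn p t) zero * y * M p (suc r))
  ...   | x , eliminated , r , x≉0 = x₀ ∷ x , solves , suc r , x≉0
    where
    S : Fin (suc m) → Carrier
    S s = sum (λ r → x r * M s (suc r))
    -- Solves the pivot equation for the first unknown, as y is the inverse of the pivot.
    x₀ = - (y * S p)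
    S-eliminated : ∀ t → S (punchIn p t) ≈ M (punchIn p t) zero * y * S p
    S-eliminated t = x∙y⁻¹≈ε⇒x≈y _ _ (begin
      S s - e * S p
        ≈⟨ +-congˡ (-‿distribˡ-* e (S p)) ⟩
      S s + - e * S p
        ≈⟨ +-congˡ (*-distribˡ-sum (- e) (λ r → x r * M p (suc r))) ⟩
      S s + sum (λ r → - e * (x r * M p (suc r)))
        ≈⟨ ∑-distrib-+ (λ r → x r * M s (suc r)) (λ r → - e * (x r * M p (suc r))) ⟨
      sum (λ r → x r * M s (suc r) + - e * (x r * M p (suc r)))
        ≈⟨ sum-cong-≋ (λ r → +-congˡ {x r * M s (suc r)} (move r)) ⟩
      sum (λ r → x r * M s (suc r) + x r * - (e * M p (suc r)))
        ≈⟨ sum-cong-≋ (λ r → distribˡ (x r) (M s (suc r)) (- (e * M p (suc r)))) ⟨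
      sum (λ r → x r * (M s (suc r) - e * M p (suc r)))
        ≈⟨ eliminated t ⟩
      0# ∎)
      where
      s = punchIn p t
      e = M s zero * y
      move : ∀ r → - e * (x r * M p (suc r)) ≈ x r * - (e * M p (suc r))
      move r = begin
        - e * (x r * M p (suc r)) ≈⟨ *-assoc _ _ _ ⟨
        - e * x r * M p (suc r)   ≈⟨ *-congʳ (*-comm _ _) ⟩
        x r * - e * M p (suc r)   ≈⟨ *-assoc _ _ _ ⟩
        x r * (- e * M p (suc r)) ≈⟨ *-congˡ (-‿distribˡ-* _ _) ⟨
        x r * - (e * M p (suc r)) ∎
    S≈ : ∀ s → S s ≈ M s zero * y * S p
    S≈ s with p Fin.≟ s
    ... | yes ≡.refl = trans (sym (*-identityˡ (S s))) (*-congʳ (sym Mₚy≈1))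
    ... | no p≢s with S-eliminated (punchOut p≢s)
    ...   | eq rewrite Fin.punchIn-punchOut p≢s = eq
    solves : ∀ s → x₀ * M s zero + S s ≈ 0#
    solves s = begin
      x₀ * M s zero + S s                              ≈⟨ +-cong (*-comm _ _) (S≈ s) ⟩
      M s zero * - (y * S p) + M s zero * y * S p      ≈⟨ +-cong (sym (-‿distribʳ-* _ _)) (*-assoc _ _ _) ⟩
      - (M s zero * (y * S p)) + M s zero * (y * S p)  ≈⟨ -‿inverseˡ _ ⟩
      0#                                               ∎

  private
    -- Just m homogeneous equations in m + 1 unknowns, so that a nonzero solution exists: i of them
    -- kill the coordinates in row positions below i, the one of index i is φ, and m - 1 - i belong
    -- to the columns in positions above i + 1. Positions of rows are counted by ρ, those of columns
    -- by σ; the remaining columns are left to the zero block.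
    equations : ∀ {m} → Matrix (suc m) → Vector Carrier (suc m) →
                (ρ σ : Permutation′ (suc m)) → Fin m → Fin m → Fin (suc m) → Carrier
    equations C φ ρ σ i s r with Fin.<-cmp s i
    ... | tri< _ _ _ = 1ᴹ r (ρ ⟨$⟩ˡ inject₁ s)
    ... | tri≈ _ _ _ = φ r
    ... | tri> _ _ _ = C r (σ ⟨$⟩ˡ suc s)

  -- A nonzero solution x of the m equations is supported on the rows r with
  -- i ≤ ρ r, hence killed by C as well as by φ.
  corankOne⇒¬zeroBlock :
    ∀ {m} (C : Matrix (suc m)) (φ : Vector Carrier (suc m)) →
    (∀ x → sum (λ r → x r * φ r) ≈ 0# → (∀ s → (x ᵛ*ᴹ C) s ≈ 0#) → ∀ r → x r ≈ 0#) →
    ∀ (ρ σ : Permutation′ (suc m)) (i : Fin m) →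
    ¬ (∀ r s → toℕ i ℕ.≤ toℕ (ρ ⟨$⟩ʳ r) → toℕ (σ ⟨$⟩ʳ s) ℕ.≤ suc (toℕ i) → C r s ≈ 0#)
  corankOne⇒¬zeroBlock {m} C φ injective ρ σ i zeroBlock
    with nontrivialSolution (equations C φ ρ σ i)
  ... | x , solves , r , x≉0 = x≉0 (injective x φx≈0 xC≈0 r)
    where
    φx≈0 : sum (λ r → x r * φ r) ≈ 0#
    φx≈0 with Fin.<-cmp i i | solves i
    ... | tri< _ i≢i _ | _  = contradiction ≡.refl i≢i
    ... | tri≈ _ _ _   | eq = eq
    ... | tri> _ i≢i _ | _  = contradiction ≡.refl i≢i

    x-ρ≈0 : ∀ s → s Fin.< i → x (ρ ⟨$⟩ˡ inject₁ s) ≈ 0#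
    x-ρ≈0 s s<i with Fin.<-cmp s i | solves s
    ... | tri< _ _ _   | eq = trans (sym (ᵛ*ᴹ-1ᴹ x _)) eq
    ... | tri≈ s≮i _ _ | _  = contradiction s<i s≮i
    ... | tri> s≮i _ _ | _  = contradiction s<i s≮i

    x≈0 : ∀ r → toℕ (ρ ⟨$⟩ʳ r) ℕ.< toℕ i → x r ≈ 0#
    x≈0 r ρr<i =
      trans (reflexive (≡.cong x (≡.sym r≡))) (x-ρ≈0 s (≡.subst (ℕ._< toℕ i) (≡.sym toℕs≡) ρr<i))
      where
      ρr<m = ℕ.<-trans ρr<i (Fin.toℕ<n i)
      s = fromℕ< ρr<m
      toℕs≡ : toℕ s ≡ toℕ (ρ ⟨$⟩ʳ r)
      toℕs≡ = Fin.toℕ-fromℕ< ρr<m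
      r≡ : ρ ⟨$⟩ˡ inject₁ s ≡ r
      r≡ =
        ≡.trans (≡.cong (ρ ⟨$⟩ˡ_) (Fin.toℕ-injective (≡.trans (Fin.toℕ-inject₁ s) toℕs≡))) (inverseˡ ρ)

    xC-σ≈0 : ∀ s → i Fin.< s → (x ᵛ*ᴹ C) (σ ⟨$⟩ˡ suc s) ≈ 0#
    xC-σ≈0 s i<s with Fin.<-cmp s i | solves s
    ... | tri< _ _ i≮s | _  = contradiction i<s i≮s
    ... | tri≈ _ _ i≮s | _  = contradiction i<s i≮s
    ... | tri> _ _ _   | eq = eq

    xC≈0 : ∀ s → (x ᵛ*ᴹ C) s ≈ 0#
    xC≈0 s with toℕ (σ ⟨$⟩ʳ s) ℕ.≤? suc (toℕ i)
    ... | yes σs≤ = sum-≈0 term≈0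
      where
      term≈0 : ∀ r → x r * C r s ≈ 0#
      term≈0 r with toℕ i ℕ.≤? toℕ (ρ ⟨$⟩ʳ r)
      ... | yes i≤ρr = trans (*-congˡ (zeroBlock r s i≤ρr σs≤)) (zeroʳ (x r))
      ... | no  i≰ρr = trans (*-congʳ (x≈0 r (ℕ.≰⇒> i≰ρr))) (zeroˡ (C r s))
    ... | no σs≰ with σ ⟨$⟩ʳ s in σs≡
    ...   | zero  = contradiction ℕ.z≤n σs≰
    ...   | suc t = trans (reflexive (≡.cong (x ᵛ*ᴹ C) (≡.trans (≡.sym (inverseˡ σ)) (≡.cong (σ ⟨$⟩ˡ_) σs≡))))
                          (xC-σ≈0 t (ℕ.s<s⁻¹ (ℕ.≰⇒> σs≰)))

-- Lattices over k[[z²]], their spans and residue spaces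

↑-elim : ∀ {p m n} (P : Fin (m ℕ.+ n) → Set p) →
         (∀ i → P (i ↑ˡ n)) → (∀ j → P (m ↑ʳ j)) → ∀ k → P k
↑-elim {m = m} {n} P left right k with splitAt m k in eq
... | inj₁ i = ≡.subst P (Fin.splitAt⁻¹-↑ˡ eq) (left i)
... | inj₂ j = ≡.subst P (Fin.splitAt⁻¹-↑ʳ eq) (right j)

module Lattices {c ℓ} {R : CommutativeRing c ℓ} (L : LaurentRing R) where
  private module R = CommutativeRing R
  open LaurentRing L
  open CommutativeRing commutativeRing hiding (zero)
  open Matrices rawRing
  open MatrixProperties commutativeRing
  private
    module I = IsSubring Integral-isSubring
    module E = IsSubring Even-isSubring
    variable
      p q : Level
      m n : ℕ

  Vec : ℕ → Set c
  Vec n = Vector Carrier n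

  zᵛ : Vec n → Vec n
  zᵛ x i = z^ 1ℤ * x i

  record IsLattice {n} (E : Pred (Vec n) p) : Set (c ⊔ ℓ ⊔ p) where
    field
      resp      : ∀ {x y} → x ≈ᵛ y → x ∈ E → y ∈ E
      0ᵛ∈       : replicate n 0# ∈ E
      z²-closed : ∀ {x} → x ∈ E → zᵛ (zᵛ x) ∈ E

  -- For a k[[z²]]-lattice E this is E ⊕ zE, the k[[z]]-lattice it spans.
  Span : Pred (Vec n) p → Pred (Vec n) (c ⊔ ℓ ⊔ p)
  Span E w = ∃[ x ] ∃[ y ] x ∈ E × y ∈ E × w ≈ᵛ x +ᵛ zᵛ y

  Span-resp : ∀ {E : Pred (Vec n) p} {v w} → v ≈ᵛ w → v ∈ Span E → w ∈ Span E
  Span-resp v≈w (x , y , x∈E , y∈E , v≈) = x , y , x∈E , y∈E , λ i → trans (sym (v≈w i)) (v≈ i)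

  z^suc-* : ∀ e f → z^ (+ suc e) * f ≈ z^ 1ℤ * (z^ (+ e) * f)
  z^suc-* e f = trans (*-congʳ (z^-+ 1ℤ (+ e))) (*-assoc _ _ _)

  module _ {E : Pred (Vec n) p} (E-isLattice : IsLattice E) where
    open IsLattice E-isLattice

    ∈⇒∈Span : ∀ {x} → x ∈ E → x ∈ Span E
    ∈⇒∈Span {x} x∈E = x , replicate _ 0# , x∈E , 0ᵛ∈ ,
      λ i → sym (trans (+-congˡ (zeroʳ (z^ 1ℤ))) (+-identityʳ (x i)))

    -- z (x + z y) = z² y + z x, and z² y lies in E: this is why two summands suffice for a
    -- k[[z]]-module.
    Span-z : ∀ {w} → w ∈ Span E → zᵛ w ∈ Span E
    Span-z (x , y , x∈E , y∈E , w≈) = zᵛ (zᵛ y) , x , z²-closed y∈E , x∈E ,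
      λ i → trans (*-congˡ (w≈ i)) (trans (distribˡ _ _ _) (+-comm _ _))

    Span-z^ : ∀ n {e x} → z^ (+ e) *ᵛ x ∈ Span E → z^ (+ (n ℕ.+ e)) *ᵛ x ∈ Span E
    Span-z^ zero    x∈ = x∈
    Span-z^ (suc n) {e} {x} x∈ =
      Span-resp {E = E} (λ i → sym (z^suc-* (n ℕ.+ e) (x i))) (Span-z (Span-z^ n x∈))

  -- The vector lifts the unit vector of index ι from the residue field. The exponent is a natural
  -- number because no block contributes a negative entry.
  record Generated (E : Pred (Vec n) p) (a : Vector ℤ n) (ι : Fin n) : Set (c ⊔ ℓ ⊔ p) where
    field
      exponent : ℕ
      vector   : Vec n
      a≡       : a ι ≡ + exponent
      integral : ∀ i → vector i ∈ Integral
      diagonal : constantTerm (vector ι) R.≈ R.1#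
      offDiagonal : ∀ i → i ≢ ι → constantTerm (vector i) R.≈ R.0#
      ∈Span    : z^ (+ exponent) *ᵛ vector ∈ Span E

  Bounded : Pred (Vec n) p → Vector ℤ n → Fin n → Set (c ⊔ ℓ ⊔ p)
  Bounded E a ι = ∀ e x → (∀ i → x i ∈ Integral) → z^ (+ e) *ᵛ x ∈ Span E →
                  + e ℤ.< a ι → constantTerm (x ι) R.≈ R.0#

  -- Modulo z, the vectors x with zᵉ x in Span E are spanned by the unit vectors
  -- of index ι with a ι ≤ e.
  record Adapted (E : Pred (Vec n) p) (a : Vector ℤ n) : Set (c ⊔ ℓ ⊔ p) where
    field
      generated : ∀ ι → Generated E a ι
      bounded   : ∀ ι → Bounded E a ι

  Span-mono : {E : Pred (Vec n) p} {F : Pred (Vec n) q} → E ⊆ F → Span E ⊆ Span F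
  Span-mono E⊆F (x , y , x∈E , y∈E , w≈) = x , y , E⊆F x∈E , E⊆F y∈E , w≈

  Generated-mono : {E : Pred (Vec n) p} {F : Pred (Vec n) q} {a : Vector ℤ n} {ι : Fin n} →
                   E ⊆ F → Generated E a ι → Generated F a ι
  Generated-mono {E = E} {F} E⊆F G = record
    { exponent    = G.exponent
    ; vector      = G.vector
    ; a≡          = G.a≡
    ; integral    = G.integral
    ; diagonal    = G.diagonal
    ; offDiagonal = G.offDiagonal
    ; ∈Span       = Span-mono {E = E} {F} E⊆F G.∈Span
    }
    where module G = Generated G

  Bounded-antitone : {E : Pred (Vec n) p} {F : Pred (Vec n) q} {a : Vector ℤ n} {ι : Fin n} →
                     E ⊆ F → Bounded F a ι → Bounded E a ι
  Bounded-antitone {E = E} {F} E⊆F bounded e x x∈ zx∈ =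
    bounded e x x∈ (Span-mono {E = E} {F} E⊆F zx∈)

  Adapted-resp : {E : Pred (Vec n) p} {F : Pred (Vec n) q} {a : Vector ℤ n} →
                 E ⊆ F → F ⊆ E → Adapted E a → Adapted F a
  Adapted-resp {a = a} E⊆F F⊆E E-adapted = record
    { generated = λ ι → Generated-mono E⊆F (generated ι)
    ; bounded   = λ ι → Bounded-antitone {a = a} F⊆E (bounded ι)
    }
    where open Adapted E-adapted

  constantTerm-sum : ∀ {n} (x : Vec n) →
                     constantTerm (sum x) R.≈ MatrixProperties.sum R (constantTerm ∘ x)
  constantTerm-sum {zero}  x = coeff-0# 0ℤ
  constantTerm-sum {suc n} x =
    R.trans (coeff-+ (x zero) (sum (x ∘ suc)) 0ℤ) (R.+-congˡ (constantTerm-sum (x ∘ suc)))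

  module Residue = MatrixProperties R
  module ResidueM = Matrices R.rawRing

  residue : Matrix n → ResidueM.Matrix n
  residue M i j = constantTerm (M i j)

  constantTerm-ᵛ*ᴹ : ∀ {x : Vec n} {M : Matrix n} → (∀ i → x i ∈ Integral) →
                     (∀ i j → M i j ∈ Integral) →
                     ∀ j → constantTerm ((x ᵛ*ᴹ M) j) R.≈ ((constantTerm ∘ x) Residue.ᵛ*ᴹ residue M) j
  constantTerm-ᵛ*ᴹ {n = n} {x} {M} x∈ M∈ j = R.trans (constantTerm-sum (λ k → x k * M k j))
    (Residue.sum-cong-≋ {n} (λ k → constantTerm-* (x∈ k) (M∈ k j)))

  -- The lift of the unit vector ι is mapped by C to a vector whose residue is row ι of the residue
  -- of C. As C commutes with z, the image times z to the power a ι lies in the span of F, and a ι <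
  -- b κ is below the exponent at which coordinate κ may become nonzero.
  residue-vanishes :
    {E : Pred (Vec n) p} {F : Pred (Vec n) q} {a b : Vector ℤ n} → IsLattice E →
    IsLattice F → Adapted E a → Adapted F b →
    ∀ {C} → (∀ i j → C i j ∈ Integral) → (∀ {x} → x ∈ E → x ᵛ*ᴹ C ∈ F) →
    ∀ ι κ → a ι ℤ.< b κ → constantTerm (C ι κ) R.≈ R.0#
  residue-vanishes {n = n} {E = E} {F} {a} {b} E-lattice F-lattice E-adapted F-adapted {C} C∈ maps
    ι κ a<b = begin
    constantTerm (C ι κ)
      ≈⟨ Residue.*ᴹ-identityˡ (residue C) ι κ ⟨
    (ResidueM.1ᴹ ι Residue.ᵛ*ᴹ residue C) κ
      ≈⟨ Residue.ᵛ*ᴹ-cong {M = residue C} unit (λ _ _ → R.refl) κ ⟨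
    ((constantTerm ∘ vector) Residue.ᵛ*ᴹ residue C) κ
      ≈⟨ constantTerm-ᵛ*ᴹ {x = vector} {C} integral C∈ κ ⟨
    constantTerm ((vector ᵛ*ᴹ C) κ)
      ≈⟨ Adapted.bounded F-adapted κ exponent (vector ᵛ*ᴹ C)
           (ᵛ*ᴹ-closed Integral-isSubring {x = vector} {C} integral C∈) (maps-Span ∈Span)
           (≡.subst (ℤ._< b κ) a≡ a<b) ⟩
    R.0# ∎
    where
    open SetoidReasoning R.setoid
    open Generated (Adapted.generated E-adapted ι)
    unit : ∀ k → constantTerm (vector k) R.≈ ResidueM.1ᴹ ι k
    unit k with ι Fin.≟ k
    ... | yes ≡.refl = R.trans diagonal (R.reflexive (≡.sym (Residue.1ᴹ-diagonal ι)))
    ... | no ι≢k     = R.trans (offDiagonal k (ι≢k ∘ ≡.sym)) (R.reflexive (≡.sym (Residue.1ᴹ-offDiagonal ι k ι≢k)))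
    maps-Span : ∀ {e x} → z^ (+ e) *ᵛ x ∈ Span E → z^ (+ e) *ᵛ (x ᵛ*ᴹ C) ∈ Span F
    maps-Span {e} {x} (y , y′ , y∈ , y′∈ , x≈) = y ᵛ*ᴹ C , y′ ᵛ*ᴹ C , maps y∈ , maps y′∈ , λ i →
      trans (sym (ᵛ*ᴹ-* (z^ (+ e)) x C i))
      (trans (ᵛ*ᴹ-cong {M = C} x≈ (λ _ _ → refl) i)
      (trans (ᵛ*ᴹ-+ y (zᵛ y′) C i) (+-congˡ (ᵛ*ᴹ-* (z^ 1ℤ) y′ C i))))

  infixr 5 _⊞_

  _⊞_ : Pred (Vec m) p → Pred (Vec n) q → Pred (Vec (m ℕ.+ n)) (p ⊔ q)
  _⊞_ {m} {n = n} E F x = (λ i → x (i ↑ˡ n)) ∈ E × (λ j → x (m ↑ʳ j)) ∈ F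

  private
    ++-↑ˡ : ∀ (x : Vec m) (y : Vec n) i → (x ++ y) (i ↑ˡ n) ≈ x i
    ++-↑ˡ x y i = reflexive (lookup-++ˡ x y i)

    ++-↑ʳ : ∀ (x : Vec m) (y : Vec n) j → (x ++ y) (m ↑ʳ j) ≈ y j
    ++-↑ʳ x y j = reflexive (lookup-++ʳ x y j)

  module _ {E : Pred (Vec m) p} {F : Pred (Vec n) q} (E-lattice : IsLattice E) (F-lattice : IsLattice F)
    where
    private
      module EL = IsLattice E-lattice
      module FL = IsLattice F-lattice

    ++∈⊞ : ∀ {x y} → x ∈ E → y ∈ F → x ++ y ∈ E ⊞ F
    ++∈⊞ {x} {y} x∈ y∈ = EL.resp (λ i → sym (++-↑ˡ x y i)) x∈ , FL.resp (λ j → sym (++-↑ʳ x y j)) y∈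

    Span-⊞ˡ : ∀ {w} → w ∈ Span (E ⊞ F) → (λ i → w (i ↑ˡ n)) ∈ Span E
    Span-⊞ˡ (x , y , (x∈ , _) , (y∈ , _) , w≈) = _ , _ , x∈ , y∈ , λ i → w≈ (i ↑ˡ n)

    Span-⊞ʳ : ∀ {w} → w ∈ Span (E ⊞ F) → (λ j → w (m ↑ʳ j)) ∈ Span F
    Span-⊞ʳ (x , y , (_ , x∈) , (_ , y∈) , w≈) = _ , _ , x∈ , y∈ , λ j → w≈ (m ↑ʳ j)

    Span-++ : ∀ {v w} → v ∈ Span E → w ∈ Span F → v ++ w ∈ Span (E ⊞ F)
    Span-++ {v} {w} (x , x′ , x∈ , x′∈ , v≈) (y , y′ , y∈ , y′∈ , w≈) =
      x ++ y , x′ ++ y′ , ++∈⊞ x∈ y∈ , ++∈⊞ x′∈ y′∈ , ↑-elim {m = m} _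
        (λ i → trans (++-↑ˡ v w i) (trans (v≈ i)
          (sym (+-cong (++-↑ˡ x y i) (*-congˡ (++-↑ˡ x′ y′ i))))))
        (λ j → trans (++-↑ʳ v w j) (trans (w≈ j)
          (sym (+-cong (++-↑ʳ x y j) (*-congˡ (++-↑ʳ x′ y′ j))))))

    -- Lifts are padded with zeros; bounds are inherited because each half of a vector in the span
    -- lies in the span of its summand.
    Adapted-⊞ : ∀ {a b} → Adapted E a → Adapted F b → Adapted (E ⊞ F) (a ++ b)
    Adapted-⊞ {a} {b} E-adapted F-adapted = record
      { generated = ↑-elim _ generatedˡ generatedʳ
      ; bounded   = ↑-elim _
          (λ i e x x∈ zx∈ e< → EA.bounded i e _ (λ k → x∈ (k ↑ˡ n)) (Span-⊞ˡ zx∈)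
            (≡.subst (+ e ℤ.<_) (lookup-++ˡ a b i) e<))
          (λ j e x x∈ zx∈ e< → FA.bounded j e _ (λ k → x∈ (m ↑ʳ k)) (Span-⊞ʳ zx∈)
            (≡.subst (+ e ℤ.<_) (lookup-++ʳ a b j) e<))
      }
      where
      module EA = Adapted E-adapted
      module FA = Adapted F-adapted
      0ᵐ = replicate m 0#
      0ⁿ = replicate n 0#
      z0∈Span : ∀ {r} {k} {G : Pred (Vec k) r} → IsLattice G → ∀ {x} → (∀ i → x i ≈ 0#) → x ∈ Span G
      z0∈Span {G = G} G-lattice x≈0 =
        Span-resp {E = G} (λ i → sym (x≈0 i)) (∈⇒∈Span G-lattice (IsLattice.0ᵛ∈ G-lattice))
      integral-++ : ∀ x y → (∀ i → x i ∈ Integral) → (∀ j → y j ∈ Integral) → ∀ k →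
                    (x ++ y) k ∈ Integral
      integral-++ x y x∈ y∈ = ↑-elim _
        (λ i → I.resp (sym (++-↑ˡ x y i)) (x∈ i)) (λ j → I.resp (sym (++-↑ʳ x y j)) (y∈ j))
      z^*-++ : ∀ f (x : Vec m) (y : Vec n) → (f *ᵛ x) ++ (f *ᵛ y) ≈ᵛ f *ᵛ (x ++ y)
      z^*-++ f x y = ↑-elim _
        (λ i → trans (++-↑ˡ (f *ᵛ x) (f *ᵛ y) i) (*-congˡ (sym (++-↑ˡ x y i))))
        (λ j → trans (++-↑ʳ (f *ᵛ x) (f *ᵛ y) j) (*-congˡ (sym (++-↑ʳ x y j))))
      generatedˡ : ∀ i → Generated (E ⊞ F) (a ++ b) (i ↑ˡ n)
      generatedˡ i = record
        { exponent    = G.exponent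
        ; vector      = G.vector ++ 0ⁿ
        ; a≡          = ≡.trans (lookup-++ˡ a b i) G.a≡
        ; integral    = integral-++ G.vector 0ⁿ G.integral (λ _ → I.0#∈)
        ; diagonal    = R.trans (coeff-cong (++-↑ˡ G.vector 0ⁿ i) 0ℤ) G.diagonal
        ; offDiagonal = ↑-elim _
            (λ k k≢i → R.trans (coeff-cong (++-↑ˡ G.vector 0ⁿ k) 0ℤ) (G.offDiagonal k (k≢i ∘ ≡.cong (_↑ˡ n))))
            (λ k _ → R.trans (coeff-cong (++-↑ʳ G.vector 0ⁿ k) 0ℤ) (coeff-0# 0ℤ))
        ; ∈Span       = Span-resp {E = E ⊞ F} (z^*-++ _ G.vector 0ⁿ)
            (Span-++ G.∈Span (z0∈Span F-lattice (λ _ → zeroʳ _)))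
        }
        where module G = Generated (EA.generated i)
      generatedʳ : ∀ j → Generated (E ⊞ F) (a ++ b) (m ↑ʳ j)
      generatedʳ j = record
        { exponent    = G.exponent
        ; vector      = 0ᵐ ++ G.vector
        ; a≡          = ≡.trans (lookup-++ʳ a b j) G.a≡
        ; integral    = integral-++ 0ᵐ G.vector (λ _ → I.0#∈) G.integral
        ; diagonal    = R.trans (coeff-cong (++-↑ʳ 0ᵐ G.vector j) 0ℤ) G.diagonal
        ; offDiagonal = ↑-elim _
            (λ k _ → R.trans (coeff-cong (++-↑ˡ 0ᵐ G.vector k) 0ℤ) (coeff-0# 0ℤ))
            (λ k k≢j → R.trans (coeff-cong (++-↑ʳ 0ᵐ G.vector k) 0ℤ) (G.offDiagonal k (k≢j ∘ ≡.cong (m ↑ʳ_))))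
        ; ∈Span       = Span-resp {E = E ⊞ F} (z^*-++ _ 0ᵐ G.vector)
            (Span-++ (z0∈Span E-lattice (λ _ → zeroʳ _)) G.∈Span)
        }
        where module G = Generated (FA.generated j)

  -- The row lattice and the column lattice of a matrix

  RowLattice : Matrix n → Pred (Vec n) ℓ
  RowLattice M x = (∀ i → x i ∈ Integral) × (∀ j → (x ᵛ*ᴹ M) j ∈ Even)

  -- Column vectors are written as rows: u Mᵀ is the transpose of M u. In this form both lattices
  -- are mapped by `_ᵛ*ᴹ_` and share one theory.
  ColumnLattice : Matrix n → Pred (Vec n) (c ⊔ ℓ)
  ColumnLattice M x = (∀ i → x i ∈ Integral) ×
                      (∃[ u ] (∀ j → u j ∈ Even) × x ≈ᵛ u ᵛ*ᴹ M ᵀ)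

  private
    z²-even : ∀ {f} → f ∈ Even → z^ 1ℤ * (z^ 1ℤ * f) ∈ Even
    z²-even f∈ = E.resp (trans (*-congʳ (z^-+ 1ℤ 1ℤ)) (*-assoc _ _ _)) (E.*-closed (z^-even 1ℤ) f∈)

    z²-integral : ∀ {f} → f ∈ Integral → z^ 1ℤ * (z^ 1ℤ * f) ∈ Integral
    z²-integral f∈ = I.*-closed (z^-integral 1) (I.*-closed (z^-integral 1) f∈)

    zᵛzᵛ-ᵛ*ᴹ : ∀ (x : Vec n) M → zᵛ (zᵛ x) ᵛ*ᴹ M ≈ᵛ zᵛ (zᵛ (x ᵛ*ᴹ M))
    zᵛzᵛ-ᵛ*ᴹ x M j = trans (ᵛ*ᴹ-* _ (zᵛ x) M j) (*-congˡ (ᵛ*ᴹ-* _ x M j))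

  RowLattice-isLattice : ∀ (M : Matrix n) → IsLattice (RowLattice M)
  RowLattice-isLattice M = record
    { resp      = λ x≈y (x∈ , xM∈) → (λ i → I.resp (x≈y i) (x∈ i)) ,
                                     (λ j → E.resp (ᵛ*ᴹ-cong {M = M} x≈y (λ _ _ → refl) j) (xM∈ j))
    ; 0ᵛ∈       = (λ _ → I.0#∈) , (λ j → E.resp (sym (ᵛ*ᴹ-zero (λ _ → refl) M j)) E.0#∈)
    ; z²-closed = λ {x} (x∈ , xM∈) → (λ i → z²-integral (x∈ i)) ,
                                     (λ j → E.resp (sym (zᵛzᵛ-ᵛ*ᴹ x M j)) (z²-even (xM∈ j)))
    }

  ColumnLattice-isLattice : ∀ (M : Matrix n) → IsLattice (ColumnLattice M)
  ColumnLattice-isLattice M = record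
    { resp      = λ x≈y (x∈ , u , u∈ , x≈) → (λ i → I.resp (x≈y i) (x∈ i)) ,
                                             u , u∈ , (λ i → trans (sym (x≈y i)) (x≈ i))
    ; 0ᵛ∈       = (λ _ → I.0#∈) , replicate _ 0# , (λ _ → E.0#∈) ,
                  (λ j → sym (ᵛ*ᴹ-zero (λ _ → refl) (M ᵀ) j))
    ; z²-closed = λ {x} (x∈ , u , u∈ , x≈) → (λ i → z²-integral (x∈ i)) , zᵛ (zᵛ u) , (λ j → z²-even (u∈ j)) ,
                  (λ j → trans (*-congˡ (*-congˡ (x≈ j))) (sym (zᵛzᵛ-ᵛ*ᴹ u (M ᵀ) j)))
    }

  RowLattice-⊕⁺ : ∀ (M : Matrix m) (N : Matrix n) → RowLattice M ⊞ RowLattice N ⊆ RowLattice (M ⊕ N)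
  RowLattice-⊕⁺ M N {x} ((xˡ∈ , xˡM∈) , (xʳ∈ , xʳN∈)) = ↑-elim _ xˡ∈ xʳ∈ , ↑-elim _
    (λ j → E.resp (sym (ᵛ*ᴹ-⊕-↑ˡ x M N j)) (xˡM∈ j))
    (λ j → E.resp (sym (ᵛ*ᴹ-⊕-↑ʳ x M N j)) (xʳN∈ j))

  RowLattice-⊕⁻ : ∀ (M : Matrix m) (N : Matrix n) → RowLattice (M ⊕ N) ⊆ RowLattice M ⊞ RowLattice N
  RowLattice-⊕⁻ {m} {n} M N {x} (x∈ , xMN∈) =
    ((λ i → x∈ (i ↑ˡ n)) , (λ j → E.resp (ᵛ*ᴹ-⊕-↑ˡ x M N j) (xMN∈ (j ↑ˡ n)))) ,
    ((λ i → x∈ (m ↑ʳ i)) , (λ j → E.resp (ᵛ*ᴹ-⊕-↑ʳ x M N j) (xMN∈ (m ↑ʳ j))))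

  private
    ⊕ᵀ-↑ˡ : ∀ (u : Vec (m ℕ.+ n)) (M : Matrix m) (N : Matrix n) j →
            (u ᵛ*ᴹ (M ⊕ N) ᵀ) (j ↑ˡ n) ≈ ((λ i → u (i ↑ˡ n)) ᵛ*ᴹ M ᵀ) j
    ⊕ᵀ-↑ˡ u M N j = trans (ᵛ*ᴹ-cong {x = u} (λ _ → refl) (λ i k → reflexive (⊕-ᵀ M N i k)) (j ↑ˡ _))
                          (ᵛ*ᴹ-⊕-↑ˡ u (M ᵀ) (N ᵀ) j)

    ⊕ᵀ-↑ʳ : ∀ (u : Vec (m ℕ.+ n)) (M : Matrix m) (N : Matrix n) j →
            (u ᵛ*ᴹ (M ⊕ N) ᵀ) (m ↑ʳ j) ≈ ((λ i → u (m ↑ʳ i)) ᵛ*ᴹ N ᵀ) j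
    ⊕ᵀ-↑ʳ {m} u M N j =
      trans (ᵛ*ᴹ-cong {x = u} (λ _ → refl) (λ i k → reflexive (⊕-ᵀ M N i k)) (m ↑ʳ j))
                              (ᵛ*ᴹ-⊕-↑ʳ u (M ᵀ) (N ᵀ) j)

  ColumnLattice-⊕⁺ : ∀ (M : Matrix m) (N : Matrix n) →
                     ColumnLattice M ⊞ ColumnLattice N ⊆ ColumnLattice (M ⊕ N)
  ColumnLattice-⊕⁺ {m} {n} M N {x} ((xˡ∈ , u , u∈ , xˡ≈) , (xʳ∈ , v , v∈ , xʳ≈)) =
    ↑-elim _ xˡ∈ xʳ∈ , u ++ v ,
    ↑-elim {m = m} _ (λ i → E.resp (sym (++-↑ˡ u v i)) (u∈ i)) (λ j → E.resp (sym (++-↑ʳ u v j)) (v∈ j)) ,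
    ↑-elim _
      (λ j → trans (xˡ≈ j) (trans (ᵛ*ᴹ-cong {M = M ᵀ} (λ i → sym (++-↑ˡ u v i)) (λ _ _ → refl) j)
                                  (sym (⊕ᵀ-↑ˡ (u ++ v) M N j))))
      (λ j → trans (xʳ≈ j) (trans (ᵛ*ᴹ-cong {M = N ᵀ} (λ i → sym (++-↑ʳ u v i)) (λ _ _ → refl) j)
                                  (sym (⊕ᵀ-↑ʳ (u ++ v) M N j))))

  ColumnLattice-⊕⁻ : ∀ (M : Matrix m) (N : Matrix n) →
                     ColumnLattice (M ⊕ N) ⊆ ColumnLattice M ⊞ ColumnLattice N
  ColumnLattice-⊕⁻ {m} {n} M N {x} (x∈ , u , u∈ , x≈) =
    ((λ i → x∈ (i ↑ˡ n)) , (λ i → u (i ↑ˡ n)) , (λ i → u∈ (i ↑ˡ n)) ,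
      (λ j → trans (x≈ (j ↑ˡ n)) (⊕ᵀ-↑ˡ u M N j))) ,
    ((λ i → x∈ (m ↑ʳ i)) , (λ i → u (m ↑ʳ i)) , (λ i → u∈ (m ↑ʳ i)) ,
      (λ j → trans (x≈ (m ↑ʳ j)) (⊕ᵀ-↑ʳ u M N j)))

-- The lattices of the single blocks

module BlockLattices {c ℓ} {R : CommutativeRing c ℓ} (L : LaurentRing R) where
  private module R = CommutativeRing R
  open LaurentRing L
  open CommutativeRing commutativeRing hiding (zero)
  open RingProperties ring using (-‿distribʳ-*; -‿distribˡ-*; -1*x≈-x)
  private module RP = RingProperties R.ring
  open Matrices rawRing
  open MatrixProperties commutativeRing
  open Lattices L
  private
    module I = IsSubring Integral-isSubring
    module E = IsSubring Even-isSubring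

  coeff-*z^ : ∀ d f m → coeff (f * z^ d) m R.≈ coeff f (m ℤ.- d)
  coeff-*z^ d f m = R.trans (coeff-cong (*-comm f (z^ d)) m) (coeff-z^* d f m)

  -- Comparison of coefficients in degree e. Applied to zᵉ x = y + z y′ it reduces `Bounded` to two
  -- coefficients of lattice vectors.
  leadingTerm : ∀ e {f g h} → z^ (+ e) * f ≈ g + z^ 1ℤ * h →
                constantTerm f R.≈ coeff g (+ e) R.+ coeff h (+ e ℤ.- 1ℤ)
  leadingTerm e {f} {g} {h} zf≈ = begin
    constantTerm f                            ≡⟨ ≡.cong (coeff f) (ℤ.+-inverseʳ (+ e)) ⟨
    coeff f (+ e ℤ.- + e)                     ≈⟨ coeff-z^* (+ e) f (+ e) ⟨
    coeff (z^ (+ e) * f) (+ e)                ≈⟨ coeff-cong zf≈ (+ e) ⟩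
    coeff (g + z^ 1ℤ * h) (+ e)               ≈⟨ coeff-+ g (z^ 1ℤ * h) (+ e) ⟩
    coeff g (+ e) R.+ coeff (z^ 1ℤ * h) (+ e) ≈⟨ R.+-congˡ (coeff-z^* 1ℤ h (+ e)) ⟩
    coeff g (+ e) R.+ coeff h (+ e ℤ.- 1ℤ)    ∎
    where open SetoidReasoning R.setoid

  even-coeff : ∀ {f} → f ∈ Even → ∀ k {m} → m ≡ + 2 ℤ.* k ℤ.+ 1ℤ → coeff f m R.≈ R.0#
  even-coeff f∈ k ≡.refl = f∈ k

  even-coeff′ : ∀ {f} → f ∈ Even → ∀ k {m} → m ≡ + 2 ℤ.* k → coeff f (m ℤ.- 1ℤ) R.≈ R.0#
  even-coeff′ f∈ k {m} m≡ =
    even-coeff f∈ (k ℤ.- 1ℤ) (≡.trans (≡.cong (λ i → i ℤ.- 1ℤ) m≡) (lemma k))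
    where
    lemma : ∀ k → + 2 ℤ.* k ℤ.+ ℤ.- 1ℤ ≡ + 2 ℤ.* (k ℤ.+ ℤ.- 1ℤ) ℤ.+ 1ℤ
    lemma = solve-∀

  0+0≈0 : ∀ {a b} → a R.≈ R.0# → b R.≈ R.0# → a R.+ b R.≈ R.0#
  0+0≈0 a≈0 b≈0 = R.trans (R.+-cong a≈0 b≈0) (R.+-identityˡ R.0#)

  -- These three are the block matrices over an abstract `LaurentRing`; at `laurentRing` they agree
  -- definitionally with `blockMatrix`.
  oneMatrix : Matrix 1
  oneMatrix _ _ = 1#

  zMatrix : Matrix 1
  zMatrix _ _ = z^ 1ℤ

  unipMatrix : ℕ → Matrix 2
  unipMatrix i = (1# ∷ z^ 1ℤ ∷ []) ∷ (0# ∷ z^ (+ i) ∷ []) ∷ []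

  private
    a+b≈0∧b≈0⇒a≈0 : ∀ {a b} → a R.+ b R.≈ R.0# → b R.≈ R.0# → a R.≈ R.0#
    a+b≈0∧b≈0⇒a≈0 {a} {b} a+b≈0 b≈0 =
      R.trans (R.sym (R.+-identityʳ a)) (R.trans (R.+-congˡ (R.sym b≈0)) a+b≈0)

    a+b≈0∧a≈0⇒b≈0 : ∀ {a b} → a R.+ b R.≈ R.0# → a R.≈ R.0# → b R.≈ R.0#
    a+b≈0∧a≈0⇒b≈0 {a} {b} a+b≈0 a≈0 =
      R.trans (R.sym (R.+-identityˡ b)) (R.trans (R.+-congʳ (R.sym a≈0)) a+b≈0)

    x*-1≈-x : ∀ x → x * - 1# ≈ - x
    x*-1≈-x x = trans (sym (-‿distribʳ-* x 1#)) (-‿cong (*-identityʳ x))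

    ᵛ*ᴹ-1×1 : ∀ (x : Vec 1) (M : Matrix 1) j → (x ᵛ*ᴹ M) j ≈ x zero * M zero j
    ᵛ*ᴹ-1×1 x M j = +-identityʳ _

    z^0-* : ∀ f → z^ 0ℤ * f ≈ f
    z^0-* f = trans (*-congʳ z^-0) (*-identityˡ f)

    1×1-offDiagonal : ∀ {f} (i : Fin 1) → i ≢ zero → constantTerm f R.≈ R.0#
    1×1-offDiagonal zero i≢0 = contradiction ≡.refl i≢0

    m+1-1≡m : ∀ m → m ℤ.+ 1ℤ ℤ.+ ℤ.- 1ℤ ≡ m
    m+1-1≡m = solve-∀

    constantTerm-0# : constantTerm 0# R.≈ R.0#
    constantTerm-0# = coeff-0# 0ℤ

  row-one : Adapted (RowLattice oneMatrix) (0ℤ ∷ [])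
  row-one = record
    { generated = λ where
        zero → record
          { exponent    = 0
          ; vector      = λ _ → 1#
          ; a≡          = ≡.refl
          ; integral    = λ _ → I.1#∈
          ; diagonal    = constantTerm-1#
          ; offDiagonal = 1×1-offDiagonal
          ; ∈Span       = Span-resp {E = RowLattice oneMatrix} (λ i → sym (z^0-* 1#))
              (∈⇒∈Span (RowLattice-isLattice oneMatrix) ((λ _ → I.1#∈) ,
                λ j → E.resp (sym (trans (ᵛ*ᴹ-1×1 (λ _ → 1#) oneMatrix j) (*-identityˡ 1#))) E.1#∈))
          }
    ; bounded   = λ { zero _ _ _ _ (ℤ.+<+ ()) }
    }

  column-one : Adapted (ColumnLattice oneMatrix) (0ℤ ∷ [])
  column-one = record
    { generated = λ where
        zero → record
          { exponent    = 0
          ; vector      = λ _ → 1#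
          ; a≡          = ≡.refl
          ; integral    = λ _ → I.1#∈
          ; diagonal    = constantTerm-1#
          ; offDiagonal = 1×1-offDiagonal
          ; ∈Span       = Span-resp {E = ColumnLattice oneMatrix} (λ i → sym (z^0-* 1#))
              (∈⇒∈Span (ColumnLattice-isLattice oneMatrix) ((λ _ → I.1#∈) , (λ _ → 1#) , (λ _ → E.1#∈) ,
                λ j → sym (trans (ᵛ*ᴹ-1×1 (λ _ → 1#) (oneMatrix ᵀ) j) (*-identityˡ 1#))))
          }
    ; bounded   = λ { zero _ _ _ _ (ℤ.+<+ ()) }
    }

  private
    -- If x = u z with u even, then x z = u z² is even. Since `Generated` passes to larger lattices
    -- and `Bounded` to smaller ones, this inclusion lets each be proved once for both lattices.
    column-z⊆row-z : ColumnLattice zMatrix ⊆ RowLattice zMatrix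
    column-z⊆row-z {x} (x∈ , u , u∈ , x≈) = x∈ , λ j → E.resp (sym (begin
      (x ᵛ*ᴹ zMatrix) j             ≈⟨ ᵛ*ᴹ-1×1 x zMatrix j ⟩
      x zero * z^ 1ℤ                ≈⟨ *-congʳ (trans (x≈ zero) (ᵛ*ᴹ-1×1 u (zMatrix ᵀ) zero)) ⟩
      u zero * z^ 1ℤ * z^ 1ℤ        ≈⟨ *-assoc _ _ _ ⟩
      u zero * (z^ 1ℤ * z^ 1ℤ)      ≈⟨ *-congˡ (z^-+ 1ℤ 1ℤ) ⟨
      u zero * z^ (+ 2)             ∎)) (E.*-closed (u∈ zero) (z^-even 1ℤ))
      where open SetoidReasoning setoid

    z-∈-column-z : (λ _ → z^ 1ℤ) ∈ ColumnLattice zMatrix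
    z-∈-column-z = (λ _ → z^-integral 1) , (λ _ → 1#) , (λ _ → E.1#∈) ,
      λ j → sym (trans (ᵛ*ᴹ-1×1 (λ _ → 1#) (zMatrix ᵀ) j) (*-identityˡ _))

    row-z-constantTerm : ∀ {x} → x ∈ RowLattice zMatrix → constantTerm (x zero) R.≈ R.0#
    row-z-constantTerm {x} (_ , xz∈) = begin
      constantTerm (x zero)        ≈⟨ coeff-*z^ 1ℤ (x zero) 1ℤ ⟨
      coeff (x zero * z^ 1ℤ) 1ℤ    ≈⟨ coeff-cong (ᵛ*ᴹ-1×1 x zMatrix zero) 1ℤ ⟨
      coeff ((x ᵛ*ᴹ zMatrix) zero) 1ℤ ≈⟨ xz∈ zero 0ℤ ⟩
      R.0#                         ∎
      where open SetoidReasoning R.setoid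

    row-z-bounded : ∀ ι → Bounded (RowLattice zMatrix) (1ℤ ∷ []) ι
    row-z-bounded zero zero x x∈ (y , y′ , y∈ , (y′∈ , _) , zx≈) _ =
      R.trans (leadingTerm 0 (zx≈ zero)) (0+0≈0 (row-z-constantTerm y∈) (y′∈ zero -1ℤ ℤ.-<+))
    row-z-bounded zero (suc e) x x∈ _ (ℤ.+<+ (s≤s ()))

    column-z-generated : ∀ ι → Generated (ColumnLattice zMatrix) (1ℤ ∷ []) ι
    column-z-generated zero = record
      { exponent    = 1
      ; vector      = λ _ → 1#
      ; a≡          = ≡.refl
      ; integral    = λ _ → I.1#∈
      ; diagonal    = constantTerm-1#
      ; offDiagonal = 1×1-offDiagonal
      ; ∈Span       = Span-resp {E = ColumnLattice zMatrix} (λ _ → sym (*-identityʳ (z^ 1ℤ)))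
          (∈⇒∈Span (ColumnLattice-isLattice zMatrix) z-∈-column-z)
      }

  row-z : Adapted (RowLattice zMatrix) (1ℤ ∷ [])
  row-z = record
    { generated = λ ι → Generated-mono column-z⊆row-z (column-z-generated ι)
    ; bounded   = row-z-bounded
    }

  column-z : Adapted (ColumnLattice zMatrix) (1ℤ ∷ [])
  column-z = record
    { generated = column-z-generated
    ; bounded   = λ ι → Bounded-antitone {a = 1ℤ ∷ []} column-z⊆row-z (row-z-bounded ι)
    }

  -- The lattices of the block `unip i`

  module _ (i : ℕ) (1<i : 1 ℕ.< i) where
    private
      U = unipMatrix i

      ᵛ*U₀ : ∀ x → (x ᵛ*ᴹ U) zero ≈ x zero
      ᵛ*U₀ x = trans (+-cong (*-identityʳ _) (trans (+-identityʳ _) (zeroʳ _))) (+-identityʳ _)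

      ᵛ*U₁ : ∀ x → (x ᵛ*ᴹ U) (suc zero) ≈ x zero * z^ 1ℤ + x (suc zero) * z^ (+ i)
      ᵛ*U₁ x = +-congˡ (+-identityʳ _)

      ᵛ*Uᵀ₀ : ∀ u → (u ᵛ*ᴹ U ᵀ) zero ≈ u zero + u (suc zero) * z^ 1ℤ
      ᵛ*Uᵀ₀ u = +-cong (*-identityʳ _) (+-identityʳ _)

      ᵛ*Uᵀ₁ : ∀ u → (u ᵛ*ᴹ U ᵀ) (suc zero) ≈ u (suc zero) * z^ (+ i)
      ᵛ*Uᵀ₁ u = trans (+-cong (zeroʳ _) (+-identityʳ _)) (+-identityˡ _)

      ∈Row : ∀ {f g} → f ∈ Integral → g ∈ Integral → f ∈ Even → f * z^ 1ℤ + g * z^ (+ i) ∈ Even →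
             f ∷ g ∷ [] ∈ RowLattice U
      ∈Row {f} {g} f-integral g-integral f-even fzgz-even =
        (λ { zero → f-integral ; (suc zero) → g-integral }) ,
        (λ { zero → E.resp (sym (ᵛ*U₀ (f ∷ g ∷ []))) f-even
           ; (suc zero) → E.resp (sym (ᵛ*U₁ (f ∷ g ∷ []))) fzgz-even })

      ∈Column : ∀ {u v f g} → f ∈ Integral → g ∈ Integral → u ∈ Even → v ∈ Even →
                f ≈ u + v * z^ 1ℤ → g ≈ v * z^ (+ i) → f ∷ g ∷ [] ∈ ColumnLattice U
      ∈Column {u} {v} f-integral g-integral u-even v-even f≈ g≈ =
        (λ { zero → f-integral ; (suc zero) → g-integral }) , u ∷ v ∷ [] ,
        (λ { zero → u-even ; (suc zero) → v-even }) ,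
        (λ { zero → trans f≈ (sym (ᵛ*Uᵀ₀ (u ∷ v ∷ []))) ; (suc zero) → trans g≈ (sym (ᵛ*Uᵀ₁ (u ∷ v ∷ []))) })


      m-i<0 : ∀ {m} → m ℤ.< + i → m ℤ.- + i ℤ.< 0ℤ
      m-i<0 {m} m<i = ≡.subst (m ℤ.- + i ℤ.<_) (ℤ.+-inverseʳ (+ i)) (ℤ.+-monoˡ-< (ℤ.- + i) m<i)

      coeff-U₁ : ∀ f g m →
                 coeff (f * z^ 1ℤ + g * z^ (+ i)) m R.≈ coeff f (m ℤ.- 1ℤ) R.+ coeff g (m ℤ.- + i)
      coeff-U₁ f g m = R.trans (coeff-+ _ _ m) (R.+-cong (coeff-*z^ 1ℤ f m) (coeff-*z^ (+ i) g m))

      -- The first coordinate is u + v z with u and v even, so its summands live in degrees of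
      -- different parity and cannot cancel: v z is integral. A negative degree m of v that is even
      -- has m + 1 odd, hence m + 1 < 0 as well.
      column-parameter-integral : ∀ {x} ((_ , u , _) : x ∈ ColumnLattice U) →
                                  u (suc zero) ∈ Integral
      column-parameter-integral {x} (x∈ , u , u∈ , x≈) m m<0 with even⊎odd m
      ... | inj₂ (k , m≡) = even-coeff (u∈ (suc zero)) k m≡
      ... | inj₁ (k , m≡) with ℤ.<-cmp (m ℤ.+ 1ℤ) 0ℤ
      ...   | tri< m+1<0 _ _ = begin
        coeff v m                                      ≡⟨ ≡.cong (coeff v) (m+1-1≡m m) ⟨
        coeff v (m ℤ.+ 1ℤ ℤ.- 1ℤ)                      ≈⟨ coeff-*z^ 1ℤ v (m ℤ.+ 1ℤ) ⟨
        coeff (v * z^ 1ℤ) (m ℤ.+ 1ℤ)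
          ≈⟨ a+b≈0∧a≈0⇒b≈0 u+vz≈0 (even-coeff (u∈ zero) k (≡.cong (λ a → a ℤ.+ 1ℤ) m≡)) ⟩
        R.0#                                           ∎
        where
        open SetoidReasoning R.setoid
        v = u (suc zero)
        u+vz≈0 : coeff (u zero) (m ℤ.+ 1ℤ) R.+ coeff (v * z^ 1ℤ) (m ℤ.+ 1ℤ) R.≈ R.0#
        u+vz≈0 = R.trans (R.sym (coeff-+ (u zero) (v * z^ 1ℤ) (m ℤ.+ 1ℤ)))
          (R.trans (coeff-cong (sym (trans (x≈ zero) (ᵛ*Uᵀ₀ u))) (m ℤ.+ 1ℤ)) (x∈ zero (m ℤ.+ 1ℤ) m+1<0))
      ...   | tri≈ _ m+1≡0 _ = contradiction (≡.trans (≡.cong (λ a → a ℤ.+ 1ℤ) (≡.sym m≡)) m+1≡0) (odd≢0 k)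
      ...   | tri> _ _ 0<m+1 = contradiction (ℤ.i<j⇒suc[i]≤j m<0)
                (ℤ.<⇒≱ (≡.subst (0ℤ ℤ.<_) (ℤ.+-comm m 1ℤ) 0<m+1))

      column-coeff : ∀ {x} → x ∈ ColumnLattice U → ∀ m → m ℤ.< + i → coeff (x (suc zero)) m R.≈ R.0#
      column-coeff x∈L@(_ , u , _ , x≈) m m<i = R.trans
        (coeff-cong (trans (x≈ (suc zero)) (ᵛ*Uᵀ₁ u)) m)
        (R.trans (coeff-*z^ (+ i) (u (suc zero)) m) (column-parameter-integral x∈L (m ℤ.- + i) (m-i<0 m<i)))

    column-unip : Adapted (ColumnLattice U) (0ℤ ∷ + i ∷ [])
    column-unip = record
      { generated = λ where
          zero → record
            { exponent    = 0
            ; vector      = 1# ∷ 0# ∷ []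
            ; a≡          = ≡.refl
            ; integral    = λ { zero → I.1#∈ ; (suc zero) → I.0#∈ }
            ; diagonal    = constantTerm-1#
            ; offDiagonal = λ { zero 0≢0 → contradiction ≡.refl 0≢0 ; (suc zero) _ → constantTerm-0# }
            ; ∈Span       = Span-resp {E = ColumnLattice U} (λ j → sym (z^0-* ((1# ∷ 0# ∷ []) j)))
                (∈⇒∈Span (ColumnLattice-isLattice U)
                  (∈Column I.1#∈ I.0#∈ E.1#∈ E.0#∈
                    (sym (trans (+-congˡ (zeroˡ _)) (+-identityʳ 1#))) (sym (zeroˡ _))))
            }
          (suc zero) → record
            { exponent    = i
            ; vector      = 0# ∷ 1# ∷ []
            ; a≡          = ≡.refl
            ; integral    = λ { zero → I.0#∈ ; (suc zero) → I.1#∈ }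
            ; diagonal    = constantTerm-1#
            ; offDiagonal = λ { zero _ → constantTerm-0# ; (suc zero) 1≢1 → contradiction ≡.refl 1≢1 }
            -- (0, zⁱ) = (z, zⁱ) + z (-1, 0), where the two vectors come from the parameters (u, v)
            -- = (0, 1) and (-1, 0).
            ; ∈Span       = z^ 1ℤ ∷ z^ (+ i) ∷ [] , - 1# ∷ 0# ∷ [] ,
                ∈Column (z^-integral 1) (z^-integral i) E.0#∈ E.1#∈
                  (sym (trans (+-identityˡ _) (*-identityˡ _))) (sym (*-identityˡ _)) ,
                ∈Column (I.-‿closed I.1#∈) I.0#∈ (E.-‿closed E.1#∈) E.0#∈
                  (sym (trans (+-congˡ (zeroˡ _)) (+-identityʳ _))) (sym (zeroˡ _)) ,
                λ { zero       → trans (zeroʳ _) (sym (trans (+-congˡ (x*-1≈-x _)) (-‿inverseʳ _)))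
                  ; (suc zero) → trans (*-identityʳ _) (sym (trans (+-congˡ (zeroʳ _)) (+-identityʳ _))) }
            }
      ; bounded   = λ where
          zero e x x∈ zx∈ (ℤ.+<+ ())
          (suc zero) e x x∈ (y , y′ , y∈ , y′∈ , zx≈) e<i → R.trans (leadingTerm e (zx≈ (suc zero)))
            (0+0≈0 (column-coeff y∈ (+ e) e<i)
                   (column-coeff y′∈ (+ e ℤ.- 1ℤ) (ℤ.≤-<-trans (ℤ.i-j≤i (+ e) 1ℤ) e<i)))
      }

    private
      -- For odd i the power zʰ is even and zʰ z = zⁱ, so it cancels the odd series zⁱ in the second
      -- coordinate.
      h = i ℕ.∸ 1

      i≡1+h : + i ≡ 1ℤ ℤ.+ + h
      i≡1+h = ≡.cong +_ (≡.sym (ℕ.m+[n∸m]≡n (ℕ.<⇒≤ 1<i)))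

      h≡2k : ∀ k → + i ≡ + 2 ℤ.* k ℤ.+ 1ℤ → + h ≡ + 2 ℤ.* k
      h≡2k k i≡2k+1 = ≡.trans (≡.sym (m+1-1≡m (+ h))) (≡.trans (≡.cong (λ d → d ℤ.- 1ℤ)
        (≡.trans (ℤ.+-comm (+ h) 1ℤ) (≡.trans (≡.sym i≡1+h) i≡2k+1))) (m+1-1≡m (+ 2 ℤ.* k)))

      z*zʰ≈zⁱ : z^ 1ℤ * z^ (+ h) ≈ z^ (+ i)
      z*zʰ≈zⁱ = trans (sym (z^-+ 1ℤ (+ h))) (reflexive (≡.cong z^_ (≡.sym i≡1+h)))

      z^-even′ : ∀ k {d} → d ≡ + 2 ℤ.* k → z^ d ∈ Even
      z^-even′ k ≡.refl = z^-even k

      -- This rests on `1<i`: for h = 0 the generator (-zʰ, 1) would not reduce to the second unit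
      -- vector.
      zʰ-constantTerm : constantTerm (- z^ (+ h)) R.≈ R.0#
      zʰ-constantTerm = R.trans (coeff-neg (z^ (+ h)) 0ℤ) (R.trans (R.-‿cong
        (coeff-z^ (+ h) 0ℤ (λ 0≡h → ℕ.<⇒≢ (ℕ.m<n⇒0<n∸m 1<i) (ℤ.+-injective 0≡h)))) RP.-0#≈0#)

      -- If i is even, (0, 1) lies in the lattice; if i is odd, (−zⁱ⁻¹, 1) does.
      generator₁ : (∃[ k ] + i ≡ + 2 ℤ.* k) ⊎ (∃[ k ] + i ≡ + 2 ℤ.* k ℤ.+ 1ℤ) →
        Σ[ f ∈ Carrier ] f ∈ Integral × constantTerm f R.≈ R.0# × f ∷ 1# ∷ [] ∈ RowLattice U
      generator₁ (inj₁ (k , i≡2k)) = 0# , I.0#∈ , constantTerm-0# ,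
        ∈Row I.0#∈ I.1#∈ E.0#∈
          (E.resp (sym (trans (+-cong (zeroˡ _) (*-identityˡ _)) (+-identityˡ _))) (z^-even′ k i≡2k))
      generator₁ (inj₂ (k , i≡2k+1)) = - z^ (+ h) , I.-‿closed (z^-integral h) , zʰ-constantTerm ,
        ∈Row (I.-‿closed (z^-integral h)) I.1#∈ (E.-‿closed (z^-even′ k (h≡2k k i≡2k+1)))
          (E.resp (sym -zʰz+zⁱ≈0) E.0#∈)
        where
        -zʰz+zⁱ≈0 : - z^ (+ h) * z^ 1ℤ + 1# * z^ (+ i) ≈ 0#
        -zʰz+zⁱ≈0 =
          trans (+-cong (trans (sym (-‿distribˡ-* _ _)) (-‿cong (trans (*-comm _ _) z*zʰ≈zⁱ))) (*-identityˡ _))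
                          (-‿inverseˡ _)

      -- In a vector (f, g) of the lattice, f z cancels the odd part of g zⁱ, so g determines f, and
      -- g = 1 and g = z give generators. Up to sign these are (0, 1) and (zⁱ, -z) for even i, and
      -- (zʰ, -1) and (0, z) for odd i. In both cases z times the one with g = ±1, added to the
      -- other, is (zⁱ, 0).
      generator₀ : (∃[ k ] + i ≡ + 2 ℤ.* k) ⊎ (∃[ k ] + i ≡ + 2 ℤ.* k ℤ.+ 1ℤ) →
        z^ (+ i) *ᵛ (1# ∷ 0# ∷ []) ∈ Span (RowLattice U)
      generator₀ (inj₁ (k , i≡2k)) =
        z^ (+ i) ∷ - z^ 1ℤ ∷ [] , 0# ∷ 1# ∷ [] ,
        ∈Row (z^-integral i) (I.-‿closed (z^-integral 1)) (z^-even′ k i≡2k)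
          (E.resp (sym (trans (+-cong (*-comm _ _) (sym (-‿distribˡ-* _ _))) (-‿inverseʳ _))) E.0#∈) ,
        ∈Row I.0#∈ I.1#∈ E.0#∈
          (E.resp (sym (trans (+-cong (zeroˡ _) (*-identityˡ _)) (+-identityˡ _))) (z^-even′ k i≡2k)) ,
        λ { zero       → trans (*-identityʳ _) (sym (trans (+-congˡ (zeroʳ _)) (+-identityʳ _)))
          ; (suc zero) → trans (zeroʳ _) (sym (trans (+-congˡ (*-identityʳ _)) (-‿inverseˡ _))) }
      generator₀ (inj₂ (k , i≡2k+1)) =
        0# ∷ z^ 1ℤ ∷ [] , z^ (+ h) ∷ - 1# ∷ [] ,
        ∈Row I.0#∈ (z^-integral 1) E.0#∈
          (E.resp (trans (z^-+ 1ℤ (+ i)) (sym (trans (+-congʳ (zeroˡ _)) (+-identityˡ _))))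
            (z^-even′ (1ℤ ℤ.+ k) (≡.trans (≡.cong (λ d → 1ℤ ℤ.+ d) i≡2k+1) (lemma k)))) ,
        ∈Row (z^-integral h) (I.-‿closed I.1#∈) (z^-even′ k (h≡2k k i≡2k+1))
          (E.resp (sym (trans (+-cong (trans (*-comm _ _) z*zʰ≈zⁱ) (-1*x≈-x _)) (-‿inverseʳ _))) E.0#∈) ,
        λ { zero       → trans (*-identityʳ _) (sym (trans (+-identityˡ _) z*zʰ≈zⁱ))
          ; (suc zero) → trans (zeroʳ _) (sym (trans (+-congˡ (x*-1≈-x _)) (-‿inverseʳ _))) }
        where
        lemma : ∀ k → 1ℤ ℤ.+ (+ 2 ℤ.* k ℤ.+ 1ℤ) ≡ + 2 ℤ.* (1ℤ ℤ.+ k)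
        lemma = solve-∀

      row-relation : ∀ {y} → y ∈ RowLattice U → ∀ k →
        coeff (y zero) (+ 2 ℤ.* k) R.+ coeff (y (suc zero)) (+ 2 ℤ.* k ℤ.+ 1ℤ ℤ.- + i) R.≈ R.0#
      row-relation {y} (_ , yU∈) k = begin
        coeff (y zero) (+ 2 ℤ.* k) R.+ coeff (y (suc zero)) (m ℤ.- + i)
          ≡⟨ ≡.cong (λ d → coeff (y zero) d R.+ coeff (y (suc zero)) (m ℤ.- + i)) (m+1-1≡m (+ 2 ℤ.* k)) ⟨
        coeff (y zero) (m ℤ.- 1ℤ) R.+ coeff (y (suc zero)) (m ℤ.- + i)
          ≈⟨ coeff-U₁ (y zero) (y (suc zero)) m ⟨
        coeff (y zero * z^ 1ℤ + y (suc zero) * z^ (+ i)) m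
          ≈⟨ coeff-cong (ᵛ*U₁ y) m ⟨
        coeff ((y ᵛ*ᴹ U) (suc zero)) m
          ≈⟨ yU∈ (suc zero) k ⟩
        R.0# ∎
        where
        open SetoidReasoning R.setoid
        m = + 2 ℤ.* k ℤ.+ 1ℤ

      first-even : ∀ {y} → y ∈ RowLattice U → y zero ∈ Even
      first-even {y} (_ , yU∈) = E.resp (ᵛ*U₀ y) (yU∈ zero)

      -- One of the two coefficients from `leadingTerm` has odd degree in an even series and
      -- vanishes. `row-relation` turns the other into minus a coefficient of a second coordinate,
      -- of degree e - i < 0 for odd e and e + 1 - i ≤ 0 for even e; integrality settles the
      -- negative degrees.
      bounded₀ : Bounded (RowLattice U) (+ i ∷ 0ℤ ∷ []) zero
      bounded₀ e x x∈ (y , y′ , y∈ , y′∈ , zx≈) e<i =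
        R.trans (leadingTerm e (zx≈ zero)) (cases (even⊎odd (+ e)))
        where
        cases : (∃[ k ] + e ≡ + 2 ℤ.* k) ⊎ (∃[ k ] + e ≡ + 2 ℤ.* k ℤ.+ 1ℤ) →
                coeff (y zero) (+ e) R.+ coeff (y′ zero) (+ e ℤ.- 1ℤ) R.≈ R.0#
        cases (inj₁ (k , e≡2k)) = 0+0≈0
          (R.trans (R.reflexive (≡.cong (coeff (y zero)) e≡2k)) (a+b≈0∧b≈0⇒a≈0 (row-relation y∈ k)
            last≈0))
          (even-coeff′ (first-even y′∈) k e≡2k)
          where
          open SetoidReasoning R.setoid
          last≈0 : coeff (y (suc zero)) (+ 2 ℤ.* k ℤ.+ 1ℤ ℤ.- + i) R.≈ R.0#
          last≈0 rewrite ≡.sym e≡2k with ℤ.<-cmp (+ e ℤ.+ 1ℤ) (+ i)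
          ... | tri< e+1<i _ _ = proj₁ y∈ (suc zero) _ (m-i<0 e+1<i)
          -- The boundary degree 0, where integrality of y says nothing. But e = i - 1 > 0, so the
          -- second coordinate of zᵉ x has no constant term; neither has that of z y′, hence nor
          -- that of y.
          ... | tri≈ _ e+1≡i _ = begin
            coeff (y (suc zero)) (+ e ℤ.+ 1ℤ ℤ.- + i)
              ≡⟨ ≡.cong (coeff (y (suc zero))) (≡.trans (≡.cong (λ d → d ℤ.- + i) e+1≡i) (ℤ.+-inverseʳ (+ i))) ⟩
            coeff (y (suc zero)) 0ℤ
              ≈⟨ a+b≈0∧b≈0⇒a≈0 first+z≈0
                   (R.trans (coeff-z^* 1ℤ (y′ (suc zero)) 0ℤ) (proj₁ y′∈ (suc zero) -1ℤ ℤ.-<+)) ⟩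
            R.0# ∎
            where
            0<e : 0 ℕ.< e
            0<e =
              ℕ.s<s⁻¹ (≡.subst (1 ℕ.<_) (≡.sym (ℤ.+-injective (≡.trans (ℤ.+-comm 1ℤ (+ e)) e+1≡i))) 1<i)
            0-e<0 : 0ℤ ℤ.- + e ℤ.< 0ℤ
            0-e<0 = ≡.subst (ℤ._< 0ℤ) (≡.sym (ℤ.+-identityˡ (ℤ.- + e))) (ℤ.neg-mono-< (ℤ.+<+ 0<e))
            first+z≈0 : coeff (y (suc zero)) 0ℤ R.+ coeff (z^ 1ℤ * y′ (suc zero)) 0ℤ R.≈ R.0#
            first+z≈0 =
              R.trans (R.sym (coeff-+ _ _ 0ℤ)) (R.trans (coeff-cong (sym (zx≈ (suc zero))) 0ℤ)
              (R.trans (coeff-z^* (+ e) (x (suc zero)) 0ℤ) (x∈ (suc zero) _ 0-e<0)))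
          ... | tri> _ _ i<e+1 = contradiction (ℤ.i<j⇒suc[i]≤j e<i)
                (ℤ.<⇒≱ (≡.subst (+ i ℤ.<_) (ℤ.+-comm (+ e) 1ℤ) i<e+1))
        cases (inj₂ (k , e≡2k+1)) = 0+0≈0
          (even-coeff (first-even y∈) k e≡2k+1)
          (R.trans (R.reflexive (≡.cong (coeff (y′ zero)) e-1≡2k)) (a+b≈0∧b≈0⇒a≈0 (row-relation y′∈ k)
            (proj₁ y′∈ (suc zero) _ (m-i<0 (≡.subst (ℤ._< + i) e≡2k+1 e<i)))))
          where
          e-1≡2k : + e ℤ.- 1ℤ ≡ + 2 ℤ.* k
          e-1≡2k = ≡.trans (≡.cong (λ d → d ℤ.- 1ℤ) e≡2k+1) (m+1-1≡m (+ 2 ℤ.* k))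

    row-unip : Adapted (RowLattice U) (+ i ∷ 0ℤ ∷ [])
    row-unip = record
      { generated = λ where
          zero → record
            { exponent    = i
            ; vector      = 1# ∷ 0# ∷ []
            ; a≡          = ≡.refl
            ; integral    = λ { zero → I.1#∈ ; (suc zero) → I.0#∈ }
            ; diagonal    = constantTerm-1#
            ; offDiagonal = λ { zero 0≢0 → contradiction ≡.refl 0≢0 ; (suc zero) _ → constantTerm-0# }
            ; ∈Span       = generator₀ (even⊎odd (+ i))
            }
          (suc zero) → let (f , f-integral , f₀≈0 , f1∈) = generator₁ (even⊎odd (+ i)) in record
            { exponent    = 0
            ; vector      = f ∷ 1# ∷ []
            ; a≡          = ≡.refl
            ; integral    = λ { zero → f-integral ; (suc zero) → I.1#∈ }
            ; diagonal    = constantTerm-1#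
            ; offDiagonal = λ { zero _ → f₀≈0 ; (suc zero) 1≢1 → contradiction ≡.refl 1≢1 }
            ; ∈Span       = Span-resp {E = RowLattice U} (λ j → sym (z^0-* ((f ∷ 1# ∷ []) j)))
                (∈⇒∈Span (RowLattice-isLattice U) f1∈)
            }
      ; bounded   = λ { zero → bounded₀ ; (suc zero) e x x∈ zx∈ (ℤ.+<+ ()) }
      }

-- Permutations of vectors

++-↭ : ∀ {a} {A : Set a} {m m′ n n′} {w : Vector A m} {x : Vector A m′} {y : Vector A n} {z : Vector A n′} →
       w ↭ x → y ↭ z → (w ++ y) ↭ (x ++ z)
++-↭ {m = m} {m′} {n} {n′} {w} {x} {y} {z} (ρ , w≡x) (σ , y≡z) = τ , eq
  where
  τ : Permutation (m′ ℕ.+ n′) (m ℕ.+ n)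
  τ = ↔-sym (Fin.+↔⊎ {m} {n}) ↔-∘ ((ρ ⊎-↔ σ) ↔-∘ Fin.+↔⊎ {m′} {n′})
  eq : ∀ k → (w ++ y) (τ ⟨$⟩ʳ k) ≡ (x ++ z) k
  eq k with splitAt m′ k
  ... | inj₁ i = ≡.trans (≡.cong Sum.[ w , y ] (Fin.splitAt-join m n (inj₁ (ρ ⟨$⟩ʳ i)))) (w≡x i)
  ... | inj₂ j = ≡.trans (≡.cong Sum.[ w , y ] (Fin.splitAt-join m n (inj₂ (σ ⟨$⟩ʳ j)))) (y≡z j)

swap-↭ : ∀ {a} {A : Set a} (x y : A) → (x ∷ y ∷ []) ↭ (y ∷ x ∷ [])
swap-↭ x y = Permutation.transpose zero (suc zero) , λ { zero → ≡.refl ; (suc zero) → ≡.refl }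

-- General linear groups over a subring

module GeneralLinear {c ℓ} (R : CommutativeRing c ℓ) where
  open CommutativeRing R hiding (zero)
  open Matrices rawRing
  open MatrixProperties R

  matrixMonoid : ℕ → Monoid c ℓ
  matrixMonoid n = record
    { Carrier  = Matrix n
    ; _≈_      = _≈ᴹ_
    ; _∙_      = _*ᴹ_
    ; ε        = 1ᴹ
    ; isMonoid = record
      { isSemigroup = record
        { isMagma = record
          { isEquivalence = record
            { refl  = λ _ _ → refl
            ; sym   = λ p i j → sym (p i j)
            ; trans = λ p q i j → trans (p i j) (q i j)
            }
          ; ∙-cong = λ {M} {M′} {N} {N′} → *ᴹ-cong {M = M} {M′} {N} {N′}
          }
        ; assoc = *ᴹ-assoc
        }
      ; identity = *ᴹ-identityˡ , *ᴹ-identityʳ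
      }
    }

  module _ {p} {P : Pred Carrier p} (P-isSubring : IsSubring R P) {n : ℕ} where
    private
      module M = Monoid (matrixMonoid n)
      open MonoidSolver (matrixMonoid n) using (solve; _⊜_) renaming (_⊕_ to _⊙_)
      open SetoidReasoning M.setoid

    *ᴹ-closed : ∀ {M N : Matrix n} → (∀ i j → M i j ∈ P) → (∀ i j → N i j ∈ P) → ∀ i j →
                (M *ᴹ N) i j ∈ P
    *ᴹ-closed {M} {N} M∈ N∈ i = ᵛ*ᴹ-closed P-isSubring {n} {M i} {N} (M∈ i) N∈

    GL-* : ∀ {M N : Matrix n} → M ∈ GL P → N ∈ GL P → M *ᴹ N ∈ GL P
    GL-* {M} {N} (M∈ , M⁻¹ , M⁻¹∈ , MM⁻¹≈1 , M⁻¹M≈1) (N∈ , N⁻¹ , N⁻¹∈ , NN⁻¹≈1 , N⁻¹N≈1) =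
      *ᴹ-closed M∈ N∈ , N⁻¹ *ᴹ M⁻¹ , *ᴹ-closed N⁻¹∈ M⁻¹∈ ,
      cancelMiddle M N N⁻¹ M⁻¹ NN⁻¹≈1 MM⁻¹≈1 , cancelMiddle N⁻¹ M⁻¹ M N M⁻¹M≈1 N⁻¹N≈1
      where
      cancelMiddle : ∀ K L L′ K′ → L *ᴹ L′ ≈ᴹ 1ᴹ → K *ᴹ K′ ≈ᴹ 1ᴹ → (K *ᴹ L) *ᴹ (L′ *ᴹ K′) ≈ᴹ 1ᴹ
      cancelMiddle K L L′ K′ LL′≈1 KK′≈1 = begin
        (K *ᴹ L) *ᴹ (L′ *ᴹ K′) ≈⟨ solve 4 (λ a b c d → (a ⊙ b) ⊙ (c ⊙ d) ⊜ a ⊙ ((b ⊙ c) ⊙ d)) M.refl K L L′ K′ ⟩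
        K *ᴹ ((L *ᴹ L′) *ᴹ K′) ≈⟨ M.∙-congˡ {K} (M.∙-congʳ {K′} LL′≈1) ⟩
        K *ᴹ (1ᴹ *ᴹ K′)        ≈⟨ M.∙-congˡ {K} (M.identityˡ K′) ⟩
        K *ᴹ K′                ≈⟨ KK′≈1 ⟩
        1ᴹ                     ∎

    GL-⁻¹ : ∀ {M : Matrix n} ((_ , M⁻¹ , _) : M ∈ GL P) → M⁻¹ ∈ GL P
    GL-⁻¹ {M} (M∈ , M⁻¹ , M⁻¹∈ , MM⁻¹≈1 , M⁻¹M≈1) = M⁻¹∈ , M , M∈ , M⁻¹M≈1 , MM⁻¹≈1

    GL-ᵀ : ∀ {M : Matrix n} → M ∈ GL P → M ᵀ ∈ GL P
    GL-ᵀ {M} (M∈ , M⁻¹ , M⁻¹∈ , MM⁻¹≈1 , M⁻¹M≈1) =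
      (λ i j → M∈ j i) , M⁻¹ ᵀ , (λ i j → M⁻¹∈ j i) , transposed M⁻¹M≈1 , transposed MM⁻¹≈1
      where
      transposed : ∀ {K L : Matrix n} → K *ᴹ L ≈ᴹ 1ᴹ → L ᵀ *ᴹ K ᵀ ≈ᴹ 1ᴹ
      transposed {K} {L} KL≈1 i j = trans (sym (*ᴹ-ᵀ K L i j))
        (trans (KL≈1 j i) (reflexive (diag-ᵀ (λ _ → 1#) i j)))

-- Interlacing from a lattice map of residual corank at most one

module Interlacing {c ℓ} {R : CommutativeRing c ℓ} (R-isField : IsDiscreteField R) (L : LaurentRing R) where
  private module R = CommutativeRing R
  open LaurentRing L
  open CommutativeRing commutativeRing hiding (zero)
  open Matrices rawRing
  open MatrixProperties commutativeRing
  open GeneralLinear commutativeRing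
  open Lattices L
  open LinearSystems R R-isField
  private
    module k  = MatrixProperties R
    module kM = Matrices R.rawRing

  residue-*ᴹ : ∀ {n} {M N : Matrix n} → (∀ i j → M i j ∈ Integral) → (∀ i j → N i j ∈ Integral) →
               residue (M *ᴹ N) kM.≈ᴹ residue M kM.*ᴹ residue N
  residue-*ᴹ {M = M} {N} M∈ N∈ i = constantTerm-ᵛ*ᴹ {x = M i} {N} (M∈ i) N∈

  residue-diag : ∀ {n} (d : Vec n) → residue (diag d) kM.≈ᴹ kM.diag (constantTerm ∘ d)
  residue-diag d zero    zero    = R.refl
  residue-diag d zero    (suc j) = coeff-0# 0ℤ
  residue-diag d (suc i) zero    = coeff-0# 0ℤ
  residue-diag d (suc i) (suc j) = residue-diag (d ∘ suc) i j

  residue-1ᴹ : ∀ {n} → residue {n} 1ᴹ kM.≈ᴹ kM.1ᴹ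
  residue-1ᴹ zero    zero    = constantTerm-1#
  residue-1ᴹ zero    (suc j) = coeff-0# 0ℤ
  residue-1ᴹ (suc i) zero    = coeff-0# 0ℤ
  residue-1ᴹ (suc i) (suc j) = residue-1ᴹ i j

  diag-integral : ∀ {n} {d : Vec n} → (∀ i → d i ∈ Integral) → ∀ i j → diag d i j ∈ Integral
  diag-integral d∈ zero    zero    = d∈ zero
  diag-integral d∈ zero    (suc j) = IsSubring.0#∈ Integral-isSubring
  diag-integral d∈ (suc i) zero    = IsSubring.0#∈ Integral-isSubring
  diag-integral d∈ (suc i) (suc j) = diag-integral (d∈ ∘ suc) i j

  module _ {p q m} {E : Pred (Vec (suc m)) p} {F : Pred (Vec (suc m)) q} {a b : Vector ℤ (suc m)} where

    -- Suppose a′ at position i is smaller than b′ at position i + 1. Every row in position at least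
    -- i then has a smaller exponent than every column in position at most i + 1, and
    -- `residue-vanishes` makes all these entries of the residue zero: a block too large for corank
    -- 1.
    interlacing :
      IsLattice E → IsLattice F → Adapted E a → Adapted F b →
      ∀ l {C C₁ C₂} → C₁ ∈ GL Integral → C₂ ∈ GL Integral →
      C ≈ᴹ C₁ *ᴹ diag (λ i → z^ ((+ l ∷ replicate m 0ℤ) i)) *ᴹ C₂ →
      (∀ {x} → x ∈ E → x ᵛ*ᴹ C ∈ F) →
      ∀ {a′ b′} → Decreasing a′ → Decreasing b′ → a′ ↭ a → b′ ↭ b →
      ∀ (i : Fin m) → b′ (suc i) ℤ.≤ a′ (inject₁ i)
    interlacing E-lattice F-lattice E-adapted F-adapted l {C} {C₁} {C₂}
      (C₁∈ , C₁⁻¹ , C₁⁻¹∈ , C₁C₁⁻¹≈1 , _) (C₂∈ , C₂⁻¹ , C₂⁻¹∈ , C₂C₂⁻¹≈1 , _) C≈ maps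
      {a′} {b′} a′↓ b′↓ (ρ , a′≡a) (σ , b′≡b) i = ℤ.≮⇒≥ λ a′<b′ →
        corankOne⇒¬zeroBlock (residue C) (λ r → constantTerm (C₁ r zero)) injective ρ σ i λ r s i≤ρr σs≤1+i →
          residue-vanishes E-lattice F-lattice E-adapted F-adapted C∈ maps r s (begin-strict
            a r              ≡⟨ a′≡a r ⟨
            a′ (ρ ⟨$⟩ʳ r)    ≤⟨ a′↓ (≡.subst (ℕ._≤ toℕ (ρ ⟨$⟩ʳ r)) (≡.sym (Fin.toℕ-inject₁ i)) i≤ρr) ⟩
            a′ (inject₁ i)   <⟨ a′<b′ ⟩
            b′ (suc i)       ≤⟨ b′↓ σs≤1+i ⟩
            b′ (σ ⟨$⟩ʳ s)    ≡⟨ b′≡b s ⟩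
            b s              ∎)
      where
      open ℤ.≤-Reasoning
      d = λ i → z^ ((+ l ∷ replicate m 0ℤ) i)
      d∈ : ∀ i → d i ∈ Integral
      -- Here l ≥ 0 enters: it makes C integral, so that its residue exists.
      d∈ zero    = z^-integral l
      d∈ (suc _) = z^-integral 0
      C₁D∈ = *ᴹ-closed Integral-isSubring {M = C₁} {diag d} C₁∈ (diag-integral d∈)
      C∈ : ∀ i j → C i j ∈ Integral
      C∈ i j = IsSubring.resp Integral-isSubring (sym (C≈ i j))
        (*ᴹ-closed Integral-isSubring {M = C₁ *ᴹ diag d} {C₂} C₁D∈ C₂∈ i j)
      c₁ = residue C₁
      c₂ = residue C₂
      c₁⁻¹ = residue C₁⁻¹
      c₂⁻¹ = residue C₂⁻¹
      δ = constantTerm ∘ d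
      residue-inverse : ∀ {M N : Matrix (suc m)} → (∀ i j → M i j ∈ Integral) →
                        (∀ i j → N i j ∈ Integral) →
                        M *ᴹ N ≈ᴹ 1ᴹ → residue M kM.*ᴹ residue N kM.≈ᴹ kM.1ᴹ
      residue-inverse {M} {N} M∈ N∈ MN≈1 i j = R.trans (R.sym (residue-*ᴹ {M = M} {N} M∈ N∈ i j))
        (R.trans (coeff-cong (MN≈1 i j) 0ℤ) (residue-1ᴹ i j))
      c≈ : residue C kM.≈ᴹ c₁ kM.*ᴹ kM.diag δ kM.*ᴹ c₂
      c≈ i j =
        R.trans (coeff-cong (C≈ i j) 0ℤ) (R.trans (residue-*ᴹ {M = C₁ *ᴹ diag d} {C₂} C₁D∈ C₂∈ i j)
        (k.*ᴹ-cong {N = c₂} (λ i j → R.trans (residue-*ᴹ {M = C₁} {diag d} C₁∈ (diag-integral d∈) i j)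
          (k.ᵛ*ᴹ-cong {x = c₁ i} (λ _ → R.refl) (residue-diag d) j)) (λ _ _ → R.refl) i j))

      cancelʳ : ∀ x {M N} → M kM.*ᴹ N kM.≈ᴹ kM.1ᴹ → (∀ s → (x k.ᵛ*ᴹ M) s R.≈ R.0#) → ∀ s →
                x s R.≈ R.0#
      cancelʳ x {M} {N} MN≈1 xM≈0 s = R.trans (R.sym (k.ᵛ*ᴹ-1ᴹ x s))
        (R.trans (k.ᵛ*ᴹ-cong {x = x} (λ _ → R.refl) (λ i j → R.sym (MN≈1 i j)) s)
        (R.trans (R.sym (k.ᵛ*ᴹ-assoc x M N s)) (k.ᵛ*ᴹ-zero xM≈0 N s)))

      -- Cancelling the residue of C₂ leaves x c₁ δ = 0. All entries of δ but the first are 1, so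
      -- only the first coordinate of x c₁ can escape; φ, the first column of c₁, is that
      -- coordinate.
      injective : ∀ x → k.sum (λ r → x r R.* constantTerm (C₁ r zero)) R.≈ R.0# →
                  (∀ s → (x k.ᵛ*ᴹ residue C) s R.≈ R.0#) → ∀ r → x r R.≈ R.0#
      injective x φx≈0 xC≈0 =
        cancelʳ x {c₁} {c₁⁻¹} (residue-inverse {C₁} {C₁⁻¹} C₁∈ C₁⁻¹∈ C₁C₁⁻¹≈1) xc₁≈0
        where
        xc₁δ≈0 : ∀ s → (x k.ᵛ*ᴹ c₁ k.ᵛ*ᴹ kM.diag δ) s R.≈ R.0#
        xc₁δ≈0 = cancelʳ _ {c₂} {c₂⁻¹} (residue-inverse {C₂} {C₂⁻¹} C₂∈ C₂⁻¹∈ C₂C₂⁻¹≈1) λ s →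
          R.trans (k.ᵛ*ᴹ-cong {M = c₂} (k.ᵛ*ᴹ-assoc x c₁ (kM.diag δ)) (λ _ _ → R.refl) s)
          (R.trans (k.ᵛ*ᴹ-assoc x (c₁ kM.*ᴹ kM.diag δ) c₂ s)
          (R.trans (k.ᵛ*ᴹ-cong {x = x} (λ _ → R.refl) (λ i j → R.sym (c≈ i j)) s) (xC≈0 s)))
        xc₁≈0 : ∀ s → (x k.ᵛ*ᴹ c₁) s R.≈ R.0#
        xc₁≈0 zero    = φx≈0
        xc₁≈0 (suc t) = R.trans (R.sym (R.*-identityʳ _)) (R.trans
          (R.*-congˡ (R.sym (R.trans (coeff-cong z^-0 0ℤ) constantTerm-1#)))
          (R.trans (R.sym (k.ᵛ*ᴹ-diag (x k.ᵛ*ᴹ c₁) δ (suc t))) (xc₁δ≈0 (suc t))))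

  -- Lattice maps from the decompositions of A, B and AB

  module _ {m} (l : ℕ) (A B Mᵃ Mᵇ : Matrix (suc m)) {q r p p′ h h′ : Matrix (suc m)}
    (q∈ : q ∈ GL Integral) (r∈ : r ∈ GL Integral) (p∈ : p ∈ GL Integral) (p′∈ : p′ ∈ GL Integral)
    (h∈ : h ∈ GL Even) (h′∈ : h′ ∈ GL Even)
    (A≈qDr : A ≈ᴹ q *ᴹ diag (λ i → z^ ((+ l ∷ replicate m 0ℤ) i)) *ᴹ r)
    (B≈pMᵃh : B ≈ᴹ p *ᴹ Mᵃ *ᴹ h) (AB≈p′Mᵇh′ : A *ᴹ B ≈ᴹ p′ *ᴹ Mᵇ *ᴹ h′) where
    private
      module M = Monoid (matrixMonoid (suc m))
      open MonoidSolver (matrixMonoid (suc m)) using (solve; _⊜_) renaming (_⊕_ to _⊙_)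
      D = diag (λ i → z^ ((+ l ∷ replicate m 0ℤ) i))
      p′⁻¹ = proj₁ (proj₂ p′∈)
      h⁻¹  = proj₁ (proj₂ h∈)
      -- Grouping p′⁻¹ (q D r) p around D exhibits C with the same dominant coweight as A.
      C₁ = p′⁻¹ *ᴹ q
      C₂ = r *ᴹ p
      C  = C₁ *ᴹ D *ᴹ C₂
      T  = h′ *ᴹ h⁻¹

      C₁∈ : C₁ ∈ GL Integral
      C₁∈ = GL-* Integral-isSubring {M = p′⁻¹} {q} (GL-⁻¹ Integral-isSubring {M = p′} p′∈) q∈

      C₂∈ : C₂ ∈ GL Integral
      C₂∈ = GL-* Integral-isSubring {M = r} {p} r∈ p∈

      CMᵃ≈MᵇT : C *ᴹ Mᵃ ≈ᴹ Mᵇ *ᴹ T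
      CMᵃ≈MᵇT = begin
        (p′⁻¹ *ᴹ q) *ᴹ D *ᴹ (r *ᴹ p) *ᴹ Mᵃ
          ≈⟨ solve 6 (λ p′⁻¹ q D r p M → (((p′⁻¹ ⊙ q) ⊙ D) ⊙ (r ⊙ p)) ⊙ M ⊜ (p′⁻¹ ⊙ ((q ⊙ D) ⊙ r)) ⊙ (p ⊙ M))
               M.refl p′⁻¹ q D r p Mᵃ ⟩
        p′⁻¹ *ᴹ (q *ᴹ D *ᴹ r) *ᴹ (p *ᴹ Mᵃ)
          ≈⟨ M.∙-cong {p′⁻¹ *ᴹ (q *ᴹ D *ᴹ r)} {p′⁻¹ *ᴹ A} {p *ᴹ Mᵃ} {B *ᴹ h⁻¹}
               (M.∙-congˡ {p′⁻¹} {q *ᴹ D *ᴹ r} {A} (M.sym {A} A≈qDr)) pMᵃ≈Bh⁻¹ ⟩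
        p′⁻¹ *ᴹ A *ᴹ (B *ᴹ h⁻¹)
          ≈⟨ solve 4 (λ p′⁻¹ A B h⁻¹ → (p′⁻¹ ⊙ A) ⊙ (B ⊙ h⁻¹) ⊜ p′⁻¹ ⊙ ((A ⊙ B) ⊙ h⁻¹)) M.refl p′⁻¹ A B h⁻¹ ⟩
        p′⁻¹ *ᴹ (A *ᴹ B *ᴹ h⁻¹)
          ≈⟨ M.∙-congˡ {p′⁻¹} {A *ᴹ B *ᴹ h⁻¹} (M.∙-congʳ {h⁻¹} {A *ᴹ B} AB≈p′Mᵇh′) ⟩
        p′⁻¹ *ᴹ (p′ *ᴹ Mᵇ *ᴹ h′ *ᴹ h⁻¹)
          ≈⟨ solve 5 (λ p′⁻¹ p′ M h′ h⁻¹ → p′⁻¹ ⊙ (((p′ ⊙ M) ⊙ h′) ⊙ h⁻¹) ⊜ (p′⁻¹ ⊙ p′) ⊙ (M ⊙ (h′ ⊙ h⁻¹)))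
               M.refl p′⁻¹ p′ Mᵇ h′ h⁻¹ ⟩
        p′⁻¹ *ᴹ p′ *ᴹ (Mᵇ *ᴹ T)
          ≈⟨ M.∙-congʳ {Mᵇ *ᴹ T} {p′⁻¹ *ᴹ p′} {1ᴹ} (proj₂ (proj₂ (proj₂ (proj₂ p′∈)))) ⟩
        1ᴹ *ᴹ (Mᵇ *ᴹ T)
          ≈⟨ M.identityˡ (Mᵇ *ᴹ T) ⟩
        Mᵇ *ᴹ T ∎
        where
        open SetoidReasoning M.setoid
        pMᵃ≈Bh⁻¹ : p *ᴹ Mᵃ ≈ᴹ B *ᴹ h⁻¹
        pMᵃ≈Bh⁻¹ = begin
          p *ᴹ Mᵃ                 ≈⟨ M.identityʳ (p *ᴹ Mᵃ) ⟨
          p *ᴹ Mᵃ *ᴹ 1ᴹ           ≈⟨ M.∙-congˡ {p *ᴹ Mᵃ} {h *ᴹ h⁻¹} {1ᴹ} (proj₁ (proj₂ (proj₂ (proj₂ h∈)))) ⟨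
          p *ᴹ Mᵃ *ᴹ (h *ᴹ h⁻¹)   ≈⟨ M.assoc (p *ᴹ Mᵃ) h h⁻¹ ⟨
          p *ᴹ Mᵃ *ᴹ h *ᴹ h⁻¹     ≈⟨ M.∙-congʳ {h⁻¹} {B} B≈pMᵃh ⟨
          B *ᴹ h⁻¹                ∎

      C-integral : ∀ i j → C i j ∈ Integral
      C-integral = *ᴹ-closed Integral-isSubring {M = C₁ *ᴹ D} {C₂}
        (*ᴹ-closed Integral-isSubring {M = C₁} {D} (proj₁ C₁∈)
          (diag-integral λ { zero → z^-integral l ; (suc _) → z^-integral 0 }))
        (proj₁ C₂∈)

      T-even : ∀ i j → T i j ∈ Even
      T-even = *ᴹ-closed Even-isSubring {M = h′} {h⁻¹} (proj₁ h′∈) (proj₁ (proj₂ (proj₂ h∈)))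

      row-maps : ∀ {x} → x ∈ RowLattice Mᵇ → x ᵛ*ᴹ C ∈ RowLattice Mᵃ
      row-maps {x} (x∈ , xMᵇ∈) = ᵛ*ᴹ-closed Integral-isSubring {x = x} {C} x∈ C-integral , λ j →
        IsSubring.resp Even-isSubring (begin
          (x ᵛ*ᴹ Mᵇ ᵛ*ᴹ T) j   ≈⟨ ᵛ*ᴹ-assoc x Mᵇ T j ⟩
          (x ᵛ*ᴹ (Mᵇ *ᴹ T)) j  ≈⟨ ᵛ*ᴹ-cong {x = x} (λ _ → refl) CMᵃ≈MᵇT j ⟨
          (x ᵛ*ᴹ (C *ᴹ Mᵃ)) j  ≈⟨ ᵛ*ᴹ-assoc x C Mᵃ j ⟨
          (x ᵛ*ᴹ C ᵛ*ᴹ Mᵃ) j   ∎)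
          (ᵛ*ᴹ-closed Even-isSubring {x = x ᵛ*ᴹ Mᵇ} {T} xMᵇ∈ T-even j)
        where open SetoidReasoning setoid

      -- D is symmetric, so the transpose has a factorization of the same shape and `interlacing`
      -- applies to it.
      Cᵀ≈ : C ᵀ ≈ᴹ C₂ ᵀ *ᴹ D *ᴹ C₁ ᵀ
      Cᵀ≈ = begin
        (C₁ *ᴹ D *ᴹ C₂) ᵀ        ≈⟨ *ᴹ-ᵀ (C₁ *ᴹ D) C₂ ⟩
        C₂ ᵀ *ᴹ (C₁ *ᴹ D) ᵀ      ≈⟨ M.∙-congˡ {C₂ ᵀ} {(C₁ *ᴹ D) ᵀ} (*ᴹ-ᵀ C₁ D) ⟩
        C₂ ᵀ *ᴹ (D ᵀ *ᴹ C₁ ᵀ)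
          ≈⟨ M.∙-congˡ {C₂ ᵀ} {D ᵀ *ᴹ C₁ ᵀ}
               (M.∙-congʳ {C₁ ᵀ} {D ᵀ} {D} λ i j → reflexive (diag-ᵀ _ i j)) ⟩
        C₂ ᵀ *ᴹ (D *ᴹ C₁ ᵀ)      ≈⟨ M.assoc (C₂ ᵀ) D (C₁ ᵀ) ⟨
        C₂ ᵀ *ᴹ D *ᴹ C₁ ᵀ        ∎
        where open SetoidReasoning M.setoid

      column-maps : ∀ {x} → x ∈ ColumnLattice Mᵃ → x ᵛ*ᴹ C ᵀ ∈ ColumnLattice Mᵇ
      column-maps {x} (x∈ , u , u∈ , x≈uMᵃ) =
        ᵛ*ᴹ-closed Integral-isSubring {x = x} {C ᵀ} x∈ (λ i j → C-integral j i) ,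
        u ᵛ*ᴹ T ᵀ , ᵛ*ᴹ-closed Even-isSubring {x = u} {T ᵀ} u∈ (λ i j → T-even j i) , λ j → begin
          (x ᵛ*ᴹ C ᵀ) j              ≈⟨ ᵛ*ᴹ-cong {M = C ᵀ} x≈uMᵃ (λ _ _ → refl) j ⟩
          (u ᵛ*ᴹ Mᵃ ᵀ ᵛ*ᴹ C ᵀ) j     ≈⟨ ᵛ*ᴹ-assoc u (Mᵃ ᵀ) (C ᵀ) j ⟩
          (u ᵛ*ᴹ (Mᵃ ᵀ *ᴹ C ᵀ)) j    ≈⟨ ᵛ*ᴹ-cong {x = u} (λ _ → refl) (λ i k → sym (*ᴹ-ᵀ C Mᵃ i k)) j ⟩
          (u ᵛ*ᴹ (C *ᴹ Mᵃ) ᵀ) j      ≈⟨ ᵛ*ᴹ-cong {x = u} (λ _ → refl) (λ i k → CMᵃ≈MᵇT k i) j ⟩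
          (u ᵛ*ᴹ (Mᵇ *ᴹ T) ᵀ) j      ≈⟨ ᵛ*ᴹ-cong {x = u} (λ _ → refl) (*ᴹ-ᵀ Mᵇ T) j ⟩
          (u ᵛ*ᴹ (T ᵀ *ᴹ Mᵇ ᵀ)) j    ≈⟨ ᵛ*ᴹ-assoc u (T ᵀ) (Mᵇ ᵀ) j ⟨
          (u ᵛ*ᴹ T ᵀ ᵛ*ᴹ Mᵇ ᵀ) j     ∎
        where open SetoidReasoning setoid

    -- Row vectors travel from the lattice of `Mᵇ` to that of `Mᵃ`, so `interlacing` is used with
    -- the roles of a and b exchanged.
    lower-interlacing :
      ∀ {a b a′ b′} → Adapted (RowLattice Mᵃ) a → Adapted (RowLattice Mᵇ) b →
      Decreasing a′ → Decreasing b′ → a′ ↭ a → b′ ↭ b →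
      ∀ (i : Fin m) → a′ (suc i) ℤ.≤ b′ (inject₁ i)
    lower-interlacing a-adapted b-adapted a↓ b↓ a↭ b↭ =
      interlacing (RowLattice-isLattice Mᵇ) (RowLattice-isLattice Mᵃ) b-adapted a-adapted
        l C₁∈ C₂∈ (λ _ _ → refl) row-maps b↓ a↓ b↭ a↭

    upper-interlacing :
      ∀ {a b a′ b′} → Adapted (ColumnLattice Mᵃ) a → Adapted (ColumnLattice Mᵇ) b →
      Decreasing a′ → Decreasing b′ → a′ ↭ a → b′ ↭ b →
      ∀ (i : Fin m) → b′ (suc i) ℤ.≤ a′ (inject₁ i)
    upper-interlacing a-adapted b-adapted a↓ b↓ a↭ b↭ =
      interlacing (ColumnLattice-isLattice Mᵃ) (ColumnLattice-isLattice Mᵇ) a-adapted b-adapted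
        l (GL-ᵀ Integral-isSubring {M = C₂} C₂∈) (GL-ᵀ Integral-isSubring {M = C₁} C₁∈) Cᵀ≈ column-maps a↓ b↓ a↭ b↭

-- Deciding invertibility in a finite field

-- Elimination has to decide whether an entry vanishes. Enumerating the field decides whether x has
-- an inverse; if it has none, x is not apart from 0, and tightness of apartness gives x ≈ 0.
finiteField-isDiscreteField : ∀ {c ℓ₁ ℓ₂} (k : FiniteField c ℓ₁ ℓ₂) →
                              IsDiscreteField (FiniteField.commutativeRing k)
finiteField-isDiscreteField k = record { 1≉0 = 1≉0 ; zero⊎unit = zero⊎unit }
  where
  open FiniteField k using (finite; tight; invertible⇒#; #⇒invertible)
  open CommutativeRing (FiniteField.commutativeRing k) hiding (zero)
  open RingProperties ring using (-0#≈0#)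
  module F = Inverse (proj₂ finite)

  _≟_ : ∀ x y → Dec (x ≈ y)
  x ≟ y =
    map′ (λ eq → trans (sym (F.strictlyInverseʳ x)) (trans (F.from-cong eq) (F.strictlyInverseʳ y)))
               F.to-cong (F.to x Fin.≟ F.to y)

  x-0≈x : ∀ x → x - 0# ≈ x
  x-0≈x x = trans (+-congˡ -0#≈0#) (+-identityʳ x)

  1≉0 : ¬ 1# ≈ 0#
  1≉0 1≈0 = proj₂ (tight 1# 0#) 1≈0 (invertible⇒# (1# , 1*[1-0]≈1 , trans (*-comm _ _) 1*[1-0]≈1))
    where 1*[1-0]≈1 = trans (*-identityˡ _) (x-0≈x 1#)

  zero⊎unit : ∀ x → x ≈ 0# ⊎ (∃[ y ] x * y ≈ 1#)
  zero⊎unit x with Fin.any? (λ i → (x * F.from i) ≟ 1#)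
  ... | yes (i , xy≈1) = inj₂ (F.from i , xy≈1)
  ... | no  ¬unit      = inj₁ (proj₁ (tight x 0#) λ x#0 →
    let (y , _ , [x-0]y≈1) = #⇒invertible x#0
    in ¬unit (F.to y , trans (*-cong (sym (x-0≈x x)) (F.strictlyInverseʳ y)) [x-0]y≈1))

-- Adapted lattices for block diagonal matrices, and the theorem

module SymmetricCoweights {c ℓ₁ ℓ₂} (k : FiniteField c ℓ₁ ℓ₂) where
  private
    R = FiniteField.commutativeRing k
    L = laurentRing R
    module L = LaurentRing L
  open Coweights k
  open CommutativeRing L.commutativeRing hiding (zero; 0#; 1#; rawRing)
  open MatrixProperties L.commutativeRing
  open GeneralLinear L.commutativeRing
  open Lattices L
  open BlockLattices L
  open Interlacing (finiteField-isDiscreteField k) L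

  -- On the column side the two coordinates of a block unip i exchange roles.
  blockDualCoweight : ∀ {m} → Block m → Vector ℤ m
  blockDualCoweight one        = 0ℤ ∷ []
  blockDualCoweight z          = 1ℤ ∷ []
  blockDualCoweight (unip i _) = 0ℤ ∷ + i ∷ []

  dualCoweight : ∀ {n} → Blocks n → Vector ℤ n
  dualCoweight ∅       = []
  dualCoweight (b ◂ Λ) = blockDualCoweight b ++ dualCoweight Λ

  blockCoweight-↭ : ∀ {m} (b : Block m) → blockCoweight b ↭ blockDualCoweight b
  blockCoweight-↭ one        = ↭-refl {i = 1} {x = 0ℤ ∷ []}
  blockCoweight-↭ z          = ↭-refl {i = 1} {x = 1ℤ ∷ []}
  blockCoweight-↭ (unip i _) = swap-↭ (+ i) 0ℤ

  coweight-↭ : ∀ {n} (Λ : Blocks n) → blocksCoweight Λ ↭ dualCoweight Λ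
  coweight-↭ ∅       = ↭-refl {i = 0} {x = []}
  coweight-↭ (b ◂ Λ) =
    ++-↭ {w = blockCoweight b} {blockDualCoweight b} (blockCoweight-↭ b) (coweight-↭ Λ)

  row-block : ∀ {m} (b : Block m) → Adapted (RowLattice (blockMatrix b)) (blockCoweight b)
  row-block one          = row-one
  row-block z            = row-z
  row-block (unip i 1<i) = row-unip i 1<i

  row-blocks : ∀ {n} (Λ : Blocks n) → Adapted (RowLattice (blocksMatrix Λ)) (blocksCoweight Λ)
  row-blocks ∅       = record { generated = λ () ; bounded = λ () }
  row-blocks (b ◂ Λ) = Adapted-resp {a = blockCoweight b ++ blocksCoweight Λ}
    (RowLattice-⊕⁺ (blockMatrix b) (blocksMatrix Λ)) (RowLattice-⊕⁻ (blockMatrix b) (blocksMatrix Λ))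
    (Adapted-⊞ (RowLattice-isLattice (blockMatrix b)) (RowLattice-isLattice (blocksMatrix Λ))
      (row-block b) (row-blocks Λ))

  column-block : ∀ {m} (b : Block m) → Adapted (ColumnLattice (blockMatrix b)) (blockDualCoweight b)
  column-block one          = column-one
  column-block z            = column-z
  column-block (unip i 1<i) = column-unip i 1<i

  column-blocks : ∀ {n} (Λ : Blocks n) → Adapted (ColumnLattice (blocksMatrix Λ)) (dualCoweight Λ)
  column-blocks ∅       = record { generated = λ () ; bounded = λ () }
  column-blocks (b ◂ Λ) = Adapted-resp {a = blockDualCoweight b ++ dualCoweight Λ}
    (ColumnLattice-⊕⁺ (blockMatrix b) (blocksMatrix Λ)) (ColumnLattice-⊕⁻ (blockMatrix b) (blocksMatrix Λ))
    (Adapted-⊞ (ColumnLattice-isLattice (blockMatrix b)) (ColumnLattice-isLattice (blocksMatrix Λ))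
      (column-block b) (column-blocks Λ))

theorem2p3 : ∀ {c ℓ₁ ℓ₂} (k : FiniteField c ℓ₁ ℓ₂) → let open Coweights k in
    ¬ HasCharacteristic (FiniteField.commutativeRing k) 2 →
    ∀ (m l : ℕ) (A B : Matrix (suc m)) →
    A ∈ G → B ∈ G →
    HasDominantCoweight A (+ l ∷ replicate m 0ℤ) →
    ∀ (a b : Vector ℤ (suc m)) →
    HasSymmetricCoweight B a →
    HasSymmetricCoweight (A *ᴹ B) b →
    (∀ (i : Fin m) → a (suc i) ≤ b (inject₁ i)) ×
    (∀ (i : Fin m) → b (suc i) ≤ a (inject₁ i))
theorem2p3 k _ m l A B _ _ (_ , q , r , q∈ , r∈ , A≈) a b
  (a↓ , Λᵃ , a↭ , p , h , p∈ , h∈ , B≈) (b↓ , Λᵇ , b↭ , p′ , h′ , p′∈ , h′∈ , AB≈) =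
  lower-interlacing l A B (blocksMatrix Λᵃ) (blocksMatrix Λᵇ) {q} {r} {p} {p′} {h} {h′}
    q∈ r∈ p∈ p′∈ h∈ h′∈ A≈ B≈ AB≈
    {blocksCoweight Λᵃ} {blocksCoweight Λᵇ} {a} {b} (row-blocks Λᵃ) (row-blocks Λᵇ) a↓ b↓ a↭ b↭ ,
  upper-interlacing l A B (blocksMatrix Λᵃ) (blocksMatrix Λᵇ) {q} {r} {p} {p′} {h} {h′}
    q∈ r∈ p∈ p′∈ h∈ h′∈ A≈ B≈ AB≈
    {dualCoweight Λᵃ} {dualCoweight Λᵇ} {a} {b} (column-blocks Λᵃ) (column-blocks Λᵇ) a↓ b↓
    (↭-trans {i = suc m} {i = a} a↭ (coweight-↭ Λᵃ)) (↭-trans {i = suc m} {i = b} b↭ (coweight-↭ Λᵇ))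
  where
  open Coweights k using (blocksMatrix; blocksCoweight)
  open SymmetricCoweights k
  open Interlacing (finiteField-isDiscreteField k) (laurentRing (FiniteField.commutativeRing k))
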